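{- (1) Let $k\ge 2$ be an integer, let $N$ be a uniformly discrete metric space with $\operatorname{OR}_N(k)=k$, and let $\alpha$ be a quasi-isometric embedding of $N$ into a metric space $M$. Then $\operatorname{OR}_M(k)=k$. (2) In particular, if $N$ and $M$ are quasi-isometric uniformly discrete metric spaces, then $\operatorname{Br}(N)=\operatorname{Br}(M)$.
   Context: All orders are total orders. Let $(M,d)$ be a metric space. For a finite subset $X\subset M$, $l_{\mathrm{opt}}(X)$ is the minimum of $\sum_{i=1}^{m-1} d(y_i,y_{i+1})$ over all enumerations $y_1,\dots,y_m$ of $X$. If $T$ is an order on $M$ and $x_1<_T\dots<_T x_m$ are the points of $X$, put $l_T(X)=\sum_{i=1}^{m-1} d(x_i,x_{i+1})$. If $M$ has at least two points, then for $k\ge 1$ $$\operatorname{OR}_{M,T}(k)=\sup_{X\subset M,\ 2\le \#X\le k+1}\frac{l_T(X)}{l_{\mathrm{opt}}(X)};$$ if $M$ is a single point, $\operatorname{OR}_{M,T}(k)=1$ for all $k\ge1$. Put $\operatorname{OR}_M(k)=\inf_T\operatorname{OR}_{M,T}(k)$ over all orders $T$ on $M$. The order breakpoint $\operatorname{Br}(M,T)$ is the smallest integer $s\ge 1$ such that $\operatorname{OR}_{M,T}(s)<s$ ($\infty$ if no such $s$ exists), and $\operatorname{Br}(M)=\min_T \operatorname{Br}(M,T)$ over all orders $T$ on $M$. A metric space is uniformly discrete if there is $\delta>0$ such that any two distinct points are at distance at least $\delta$. A map $\alpha:N\to M$ is a quasi-isometric embedding if there are $C_1\ge1$, $C_2\ge0$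 with $\frac1{C_1}d_N(x_1,x_2)-C_2\le d_M(\alpha(x_1),\alpha(x_2))\le C_1d_N(x_1,x_2)+C_2$ for all $x_1,x_2\in N$; it is a quasi-isometry if moreover $M$ is at bounded distance from $\alpha(N)$. -}

module Defs where

open import Algebra.Apartness.Bundles using (HeytingField; HeytingCommutativeRing)
open import Algebra.Bundles using (CommutativeRing)
import Algebra.Definitions.RawMonoid as RawMonoidDefinitions
open import Data.List.Base using (List; []; _∷_; length)
import Data.List.Relation.Binary.Permutation.Setoid as Permutation
import Data.List.Relation.Unary.Sorted.TotalOrder as SortedTotalOrder
import Data.List.Relation.Unary.Unique.Setoid as UniqueSetoid
open import Data.Nat.Base as ℕ using (ℕ; suc)
open import Data.Product.Base using (Σ-syntax; ∃-syntax; _×_)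
open import Function.Bundles using (Func)
open import Function.Metric.Structures using (IsGeneralMetric)
open import Level using (Level; _⊔_; 0ℓ) renaming (suc to lsuc)
open import Relation.Binary.Bundles using (Setoid; TotalOrder)
open import Relation.Binary.Construct.Add.Supremum.NonStrict ℕ._≤_ using (_≤⁺_)
import Relation.Binary.Construct.NonStrictToStrict as NonStrictToStrict
open import Relation.Binary.Core using (Rel)
open import Relation.Binary.Structures using (IsTotalOrder)
open import Relation.Nullary.Construct.Add.Supremum using (_⁺; [_]; ⊤⁺)
open import Relation.Nullary.Negation.Core using (¬_)
open import Relation.Unary using (Pred)

module _ {a r : Level} {A : Set a} (_≤_ : Rel A r) {p : Level} (P : Pred A p) where

  IsUpperBound : A → Set (a ⊔ r ⊔ p)
  IsUpperBound u = ∀ x → P x → x ≤ u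

  IsLowerBound : A → Set (a ⊔ r ⊔ p)
  IsLowerBound l = ∀ x → P x → l ≤ x

  IsMinimum : A → Set (a ⊔ r ⊔ p)
  IsMinimum m = P m × IsLowerBound m

  IsSupremum : A → Set (a ⊔ r ⊔ p)
  IsSupremum s = IsUpperBound s × (∀ u → IsUpperBound u → s ≤ u)

  IsInfimum : A → Set (a ⊔ r ⊔ p)
  IsInfimum i = IsLowerBound i × (∀ l → IsLowerBound l → l ≤ i)

-- A Dedekind-complete ordered field.  Classically this determines the real
-- numbers up to unique isomorphism, and the apartness _#_ (being tight) is the
-- negation of _≈_.  Invertibility implies _#_ and _#_ is irreflexive, so the
-- zero ring is excluded.
record RealField : Set₁ where
  field
    heytingField : HeytingField 0ℓ 0ℓ 0ℓ

  open HeytingField heytingField public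
    using (Carrier; _≈_; _#_; _+_; _*_; -_; 0#; 1#;
           heytingCommutativeRing; #⇒invertible; invertible⇒#; tight)

  commutativeRing : CommutativeRing 0ℓ 0ℓ
  commutativeRing = HeytingCommutativeRing.commutativeRing heytingCommutativeRing

  open CommutativeRing commutativeRing public using (_-_; +-rawMonoid)

  infix 4 _≤_

  field
    _≤_          : Rel Carrier 0ℓ
    isTotalOrder : IsTotalOrder _≈_ _≤_
    +-monoˡ-≤    : ∀ {x y} z → x ≤ y → (x + z) ≤ (y + z)
    *-nonNeg     : ∀ {x y} → 0# ≤ x → 0# ≤ y → 0# ≤ (x * y)
    complete     : (P : Pred Carrier 0ℓ) → ∃[ x ] P x →
                   ∃[ u ] IsUpperBound _≤_ P u → ∃[ s ] IsSupremum _≤_ P s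

  open NonStrictToStrict _≈_ _≤_ public using (_<_)

  open RawMonoidDefinitions +-rawMonoid using () renaming (_×_ to _·_)

  fromℕ : ℕ → Carrier
  fromℕ n = n · 1#

module _ (ℝ : RealField) where

  private module ℝ = RealField ℝ

  record MetricSpace : Set₁ where
    infix 4 _≈_
    field
      Carrier  : Set
      _≈_      : Rel Carrier 0ℓ
      d        : Carrier → Carrier → ℝ.Carrier
      isMetric : IsGeneralMetric _≈_ ℝ._≈_ ℝ._≤_ ℝ.0# ℝ._+_ d

    setoid : Setoid 0ℓ 0ℓ
    setoid = record
      { isEquivalence = IsGeneralMetric.≈-isEquivalence isMetric }

module _ {ℝ : RealField} where

  private module ℝ = RealField ℝ

  record Order (M : MetricSpace ℝ) : Set₁ where
    open MetricSpace M using (Carrier; _≈_)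
    field
      _≤_          : Rel Carrier 0ℓ
      isTotalOrder : IsTotalOrder _≈_ _≤_

    totalOrder : TotalOrder 0ℓ 0ℓ 0ℓ
    totalOrder = record { isTotalOrder = isTotalOrder }

  -- Finite subsets of M are represented by duplicate-free lists `xs`; the
  -- enumerations of the subset are then the lists `ys ↭ xs`.  The quantities
  -- defined by a minimum, supremum or infimum are given as functional
  -- relations whose last argument is the value of the quantity.
  module _ (M : MetricSpace ℝ) where

    open MetricSpace M using (Carrier; _≈_; d; setoid)
    open Permutation setoid using (_↭_)
    open UniqueSetoid setoid using (Unique)

    pathLength : List Carrier → ℝ.Carrier
    pathLength []           = ℝ.0#
    pathLength (x ∷ [])     = ℝ.0#
    pathLength (x ∷ y ∷ zs) = d x y ℝ.+ pathLength (y ∷ zs)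

    OptLength : List Carrier → ℝ.Carrier → Set
    OptLength xs =
      IsMinimum ℝ._≤_ λ l → ∃[ ys ] ys ↭ xs × pathLength ys ℝ.≈ l

    -- `Sorted` is non-strict, but the lists it is applied to are
    -- duplicate-free.
    OrderLength : Order M → List Carrier → ℝ.Carrier → Set
    OrderLength T xs l =
      ∃[ ys ] ys ↭ xs × Sorted ys × pathLength ys ℝ.≈ l
      where open SortedTotalOrder (Order.totalOrder T) using (Sorted)

    -- `q` is the quotient l_T(X) / l_opt(X) for some X with 2 ≤ #X ≤ k + 1; the
    -- denominator is positive because X has two distinct points.
    OrderRatio : Order M → ℕ → Pred ℝ.Carrier 0ℓ
    OrderRatio T k q =
      ∃[ xs ] Unique xs × 2 ℕ.≤ length xs × length xs ℕ.≤ suc k ×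
      (∃[ lᵀ ] ∃[ lᵒ ] OrderLength T xs lᵀ × OptLength xs lᵒ ×
        q ℝ.* lᵒ ℝ.≈ lᵀ)

    HasTwoPoints : Set
    HasTwoPoints = ∃[ x ] ∃[ y ] ¬ (x ≈ y)

    -- `trivial` is the convention for a single point, extended to the empty
    -- space.  The ratios with parameter k lie in [1, k], so for k ≥ 1 the
    -- supremum in `sup` is a real number.
    data ORᵀ (T : Order M) (k : ℕ) (r : ℝ.Carrier) : Set where
      sup     : HasTwoPoints → IsSupremum ℝ._≤_ (OrderRatio T k) r → ORᵀ T k r
      trivial : ¬ HasTwoPoints → r ℝ.≈ ℝ.1# → ORᵀ T k r

    OR : ℕ → ℝ.Carrier → Set₁
    OR k = IsInfimum ℝ._≤_ λ r → Σ[ T ∈ Order M ] ORᵀ T k r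

    Drops : Order M → Pred ℕ 0ℓ
    Drops T s = 1 ℕ.≤ s × ∃[ r ] ORᵀ T s r × r ℝ.< ℝ.fromℕ s

    -- Breakpoints take values in ℕ ⁺, which is ℕ with a top element ⊤⁺ = ∞.
    Brᵀ : Order M → Pred (ℕ ⁺) 0ℓ
    Brᵀ T [ s ] = IsMinimum ℕ._≤_ (Drops T) s
    Brᵀ T ⊤⁺    = ∀ s → ¬ Drops T s

    Br : ℕ ⁺ → Set₁
    Br = IsMinimum _≤⁺_ λ b → Σ[ T ∈ Order M ] Brᵀ T b

    UniformlyDiscrete : Set
    UniformlyDiscrete =
      ∃[ δ ] ℝ.0# ℝ.< δ × (∀ x y → ¬ (x ≈ y) → δ ℝ.≤ d x y)

  module _ (N M : MetricSpace ℝ) where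

    private
      module N = MetricSpace N
      module M = MetricSpace M

    open Func using (to)

    IsQuasiIsometricEmbedding : Func N.setoid M.setoid → Set
    IsQuasiIsometricEmbedding α =
      ∃[ C₁ ] ∃[ C₁⁻¹ ] ∃[ C₂ ]
        ℝ.1# ℝ.≤ C₁ × C₁ ℝ.* C₁⁻¹ ℝ.≈ ℝ.1# × ℝ.0# ℝ.≤ C₂ ×
        (∀ x y →
          ((C₁⁻¹ ℝ.* N.d x y) ℝ.- C₂) ℝ.≤ M.d (to α x) (to α y) ×
          M.d (to α x) (to α y) ℝ.≤ ((C₁ ℝ.* N.d x y) ℝ.+ C₂))

    IsQuasiIsometry : Func N.setoid M.setoid → Set
    IsQuasiIsometry α =
      IsQuasiIsometricEmbedding α ×
      ∃[ D ] (∀ m → ∃[ n ] M.d m (to α n) ℝ.≤ D)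

    QuasiIsometric : Set
    QuasiIsometric = ∃[ α ] IsQuasiIsometry α

{-# OPTIONS --safe #-}
module Submission where

-- If OR_T(k) = k, some (k + 1)-point sets have a T-monotone path whose k edges
-- all nearly have the length l of a shortest path through the set.  Among three
-- consecutive points the middle one cannot lie between the others on that
-- shortest path, so points two steps apart are within e = o(l) of each other:
-- the set is a "snake" alternating between two clusters that are small compared
-- to their distance.  Conversely, running through one cluster and then the other
-- shows that the ratio of a thin snake is close to k.  Uniform discreteness
-- bounds e from below, so that the additive constant of a quasi-isometric
-- embedding α is absorbed by a multiple of e; hence α maps thin snakes for the
-- pullback of an order T to thin snakes for T.
--
-- An infimum over all orders is k only if an order exists.  Excluded middle for
-- arbitrary types acts as a choice principle, so Zermelo's construction
-- provides one.

open import Defs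
open import Algebra.Apartness.Bundles using (HeytingField)
open import Algebra.Bundles using (CommutativeRing)
import Algebra.Solver.Ring.NaturalCoefficients.Default as NaturalSolver
open import Axiom.ExcludedMiddle using (ExcludedMiddle)
open import Axiom.Extensionality.Propositional using (Extensionality)
open import Data.Bool.Base using (Bool; true)
open import Data.Bool.Properties using (⇔→≡)
open import Data.Empty using (⊥; ⊥-elim)
open import Data.List.Base using (List; []; _∷_; length; _++_; _ʳ++_; map; concatMap)
import Data.List.Extrema as Extrema
import Data.List.Membership.Setoid as Membership
open import Data.List.Properties using (length-map)
import Data.List.Relation.Binary.Equality.Setoid as ListEquality
import Data.List.Relation.Binary.Permutation.Setoid as Permutation
import Data.List.Relation.Binary.Permutation.Setoid.Properties as PermutationProperties
open import Data.List.Relation.Binary.Pointwise using ([]; _∷_)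
open import Data.List.Relation.Unary.All as All using (All; []; _∷_)
import Data.List.Relation.Unary.All.Properties as All
open import Data.List.Relation.Unary.AllPairs as AllPairs using ([]; _∷_)
open import Data.List.Relation.Unary.Any as Any using (Any; here; there)
import Data.List.Relation.Unary.Any.Properties as Any
open import Data.List.Relation.Unary.Linked as Linked using (Linked; []; [-]; _∷_)
import Data.List.Relation.Unary.Linked.Properties as Linked
import Data.List.Relation.Unary.Sorted.TotalOrder as SortedTotalOrder
import Data.List.Relation.Unary.Unique.Setoid as UniqueSetoid
open import Data.Nat.Base as ℕ using (ℕ; z≤n; s≤s)
open import Data.Nat.Induction using (<-rec)
import Data.Nat.Properties as ℕ
open import Data.Product.Base using (Σ-syntax; ∃-syntax; _×_; _,_; proj₁; proj₂)
open import Data.Product.Relation.Binary.Lex.NonStrict using (×-Lex; ×-isTotalOrder)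
open import Data.Sum.Base as Sum using (_⊎_; inj₁; inj₂)
open import Function.Base using (_∘_; _on_)
open import Function.Bundles using (Func; mk⇔)
open import Function.Metric.Structures using (IsGeneralMetric)
open import Level using (Lift; lift; lower; 0ℓ; suc)
open import Relation.Binary.Bundles using (Setoid; TotalOrder)
open import Relation.Binary.Construct.Add.Supremum.NonStrict ℕ._≤_ using ([_]; _≤⊤⁺)
import Relation.Binary.Construct.NonStrictToStrict as NonStrictToStrict
open import Relation.Binary.Core using (Rel)
open import Relation.Binary.PropositionalEquality.Core as ≡ using (_≡_)
import Relation.Binary.Reasoning.PartialOrder as PartialOrderReasoning
open import Relation.Binary.Structures using (IsTotalOrder)
open import Relation.Nullary.Construct.Add.Supremum using ([_]; ⊤⁺)
open import Relation.Nullary.Decidable using (Dec; yes; no; does; dec-true; decidable-stable; map′)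
open import Relation.Nullary.Negation.Core using (¬_)

-- Lists related two places apart, and their alternating sublists.

module _ {A : Set} where

  data SkipLinked (R : Rel A 0ℓ) : List A → Set where
    []    : SkipLinked R []
    [-]   : ∀ {x} → SkipLinked R (x ∷ [])
    [-,-] : ∀ {x y} → SkipLinked R (x ∷ y ∷ [])
    _∷_   : ∀ {x y z zs} → R x z → SkipLinked R (y ∷ z ∷ zs) → SkipLinked R (x ∷ y ∷ z ∷ zs)

  -- Positions count from 1, so the head belongs to `odds`; passing to the tail exchanges the two
  -- sublists.
  odds evens : List A → List A
  odds []       = []
  odds (x ∷ xs) = x ∷ evens xs
  evens []       = []
  evens (x ∷ xs) = odds xs

module _ {A B : Set} {R : Rel A 0ℓ} {S : Rel B 0ℓ} {f : A → B} where

  SkipLinked-map : (∀ {x y} → R x y → S (f x) (f y)) →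
                   ∀ {xs} → SkipLinked R xs → SkipLinked S (map f xs)
  SkipLinked-map g []       = []
  SkipLinked-map g [-]      = [-]
  SkipLinked-map g [-,-]    = [-,-]
  SkipLinked-map g (r ∷ rs) = g r ∷ SkipLinked-map g rs

-- Zermelo's theorem: the sets obtained from the empty set by adding one new
-- point at a time and by taking unions form a chain separating points.  The
-- sets are Boolean-valued, so that quantifying over them stays in Set.
module Zermelo (decide : ∀ (P : Set) → Dec P) (ext : Extensionality 0ℓ 0ℓ) (X : Setoid 0ℓ 0ℓ) where

  open Setoid X using (Carrier; _≈_; isEquivalence; sym; trans)

  Subset : Set
  Subset = Carrier → Bool

  infix 4 _∈_ _⊆_

  _∈_ : Carrier → Subset → Set
  x ∈ P = P x ≡ true

  _⊆_ : Subset → Subset → Set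
  P ⊆ Q = ∀ x → x ∈ P → x ∈ Q

  ⊆-refl : ∀ P → P ⊆ P
  ⊆-refl P x x∈P = x∈P

  ⊆-trans : ∀ {P Q R} → P ⊆ Q → Q ⊆ R → P ⊆ R
  ⊆-trans P⊆Q Q⊆R x x∈P = Q⊆R x (P⊆Q x x∈P)

  ⊆-antisym : ∀ {P Q} → P ⊆ Q → Q ⊆ P → P ≡ Q
  ⊆-antisym P⊆Q Q⊆P = ext λ x → ⇔→≡ (mk⇔ (P⊆Q x) (Q⊆P x))

  ⟪_⟫ : (Carrier → Set) → Subset
  ⟪ Q ⟫ x = does (decide (Q x))

  ∈⁺ : ∀ (Q : Carrier → Set) {x} → Q x → x ∈ ⟪ Q ⟫
  ∈⁺ Q q = dec-true (decide _) q

  ∈⁻ : ∀ (Q : Carrier → Set) {x} → x ∈ ⟪ Q ⟫ → Q x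
  ∈⁻ Q {x} x∈ with decide (Q x)
  ... | yes q = q
  ∈⁻ Q () | no _

  -- The witness that `decide` returns depends only on `P`, so it serves as a choice function on
  -- proper subsets. The whole class of the witness counts as fresh, which makes extensions respect
  -- `_≈_`.
  IsFresh : Subset → Carrier → Set
  IsFresh P x with decide (∃[ z ] ¬ (z ∈ P))
  ... | yes (z , _) = x ≈ z
  ... | no _        = ⊥

  IsFresh-resp : ∀ P {x y} → x ≈ y → IsFresh P x → IsFresh P y
  IsFresh-resp P x≈y fresh with decide (∃[ z ] ¬ (z ∈ P))
  ... | yes _ = trans (sym x≈y) fresh

  IsFresh-unique : ∀ P {x y} → IsFresh P x → IsFresh P y → x ≈ y
  IsFresh-unique P fx fy with decide (∃[ z ] ¬ (z ∈ P))
  ... | yes _ = trans fx (sym fy)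

  IsFresh-exists : ∀ P {x} → ¬ (x ∈ P) → ∃[ z ] ¬ (z ∈ P) × IsFresh P z
  IsFresh-exists P x∉P with decide (∃[ z ] ¬ (z ∈ P))
  ... | yes (z , z∉P) = z , z∉P , Setoid.refl X
  ... | no none       = ⊥-elim (none (_ , x∉P))

  InExtension : Subset → Carrier → Set
  InExtension P x = x ∈ P ⊎ IsFresh P x

  extend : Subset → Subset
  extend P = ⟪ InExtension P ⟫

  InUnion : (Subset → Bool) → Carrier → Set
  InUnion F x = ∃[ P ] F P ≡ true × x ∈ P

  ⋃ : (Subset → Bool) → Subset
  ⋃ F = ⟪ InUnion F ⟫

  ⊆extend : ∀ P → P ⊆ extend P
  ⊆extend P x x∈P = ∈⁺ (InExtension P) (inj₁ x∈P)

  ⋃⊆ : ∀ F {Q} → (∀ P → F P ≡ true → P ⊆ Q) → ⋃ F ⊆ Q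
  ⋃⊆ F below x x∈ with ∈⁻ (InUnion F) x∈
  ... | P , P∈F , x∈P = below P P∈F x x∈P

  ⊆⋃ : ∀ F {P} → F P ≡ true → P ⊆ ⋃ F
  ⊆⋃ F P∈F x x∈P = ∈⁺ (InUnion F) (_ , P∈F , x∈P)

  -- The tower starts from the union of the empty family, so the empty set has no constructor of its
  -- own.
  data Tower : Subset → Set where
    step  : ∀ {P} → Tower P → Tower (extend P)
    union : ∀ F → (∀ P → F P ≡ true → Tower P) → Tower (⋃ F)

  Tower-resp : ∀ {P} → Tower P → ∀ {x y} → x ≈ y → x ∈ P → y ∈ P
  Tower-resp (step {P} p) x≈y x∈ =
    ∈⁺ (InExtension P) (Sum.map (Tower-resp p x≈y) (IsFresh-resp P x≈y) (∈⁻ (InExtension P) x∈))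
  Tower-resp (union F f) x≈y x∈ with ∈⁻ (InUnion F) x∈
  ... | P , P∈F , x∈P = ⊆⋃ F P∈F _ (Tower-resp (f P P∈F) x≈y x∈P)

  -- Induction on `Q` with `P` fixed. `extend` is not monotone, so in the critical case the two
  -- inclusions are first turned into an equality of Boolean sets, and equal sets have equal
  -- extensions.
  extend-compare : ∀ {P} → (∀ {Q} → Tower Q → P ⊆ Q ⊎ extend Q ⊆ P) →
                   ∀ {Q} → Tower Q → extend P ⊆ Q ⊎ Q ⊆ P
  extend-compare compareP (step {Q} q) with extend-compare compareP q
  ... | inj₁ P⁺⊆Q = inj₁ (⊆-trans P⁺⊆Q (⊆extend Q))
  ... | inj₂ Q⊆P with compareP q
  ...   | inj₁ P⊆Q  = inj₁ (≡.subst (λ R → extend R ⊆ extend Q) (⊆-antisym Q⊆P P⊆Q) (⊆-refl (extend Q)))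
  ...   | inj₂ Q⁺⊆P = inj₂ Q⁺⊆P
  extend-compare {P} compareP (union F f) with decide (∃[ Q ] F Q ≡ true × extend P ⊆ Q)
  ... | yes (Q , Q∈F , P⁺⊆Q) = inj₁ (⊆-trans P⁺⊆Q (⊆⋃ F Q∈F))
  ... | no none = inj₂ (⋃⊆ F λ Q Q∈F → Sum.fromInj₂ (λ P⁺⊆Q → ⊥-elim (none (Q , Q∈F , P⁺⊆Q)))
                                           (extend-compare compareP (f Q Q∈F)))

  -- Induction on `P`; the induction hypothesis is exactly the assumption of `extend-compare`. The
  -- second alternative is stronger than `Q ⊆ P`, and this strength is what makes the induction
  -- pass.
  compare : ∀ {P Q} → Tower P → Tower Q → P ⊆ Q ⊎ extend Q ⊆ P
  compare {Q = Q} (step {P} p) q with extend-compare (compare p) q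
  ... | inj₁ P⁺⊆Q = inj₁ P⁺⊆Q
  ... | inj₂ Q⊆P with compare p q
  ...   | inj₁ P⊆Q  = inj₂ (≡.subst (λ R → extend R ⊆ extend P) (⊆-antisym P⊆Q Q⊆P) (⊆-refl (extend P)))
  ...   | inj₂ Q⁺⊆P = inj₂ (⊆-trans Q⁺⊆P (⊆extend P))
  compare {Q = Q} (union F f) q with decide (∃[ P ] F P ≡ true × extend Q ⊆ P)
  ... | yes (P , P∈F , Q⁺⊆P) = inj₂ (⊆-trans Q⁺⊆P (⊆⋃ F P∈F))
  ... | no none = inj₁ (⋃⊆ F λ P P∈F → Sum.fromInj₁ (λ Q⁺⊆P → ⊥-elim (none (P , P∈F , Q⁺⊆P)))
                                           (compare (f P P∈F) q))

  infix 4 _≤_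

  _≤_ : Rel Carrier 0ℓ
  x ≤ y = ∀ P → Tower P → y ∈ P → x ∈ P

  ≤-total : ∀ x y → x ≤ y ⊎ y ≤ x
  ≤-total x y with decide (∃[ P ] Tower P × y ∈ P × ¬ (x ∈ P))
  ... | no none = inj₁ λ P p y∈P → decidable-stable (decide _) λ x∉P → none (P , p , y∈P , x∉P)
  ... | yes (P , p , y∈P , x∉P) = inj₂ λ Q q x∈Q →
          Sum.[ (λ P⊆Q → P⊆Q y y∈P) , (λ Q⁺⊆P → ⊥-elim (x∉P (Q⁺⊆P x (⊆extend Q x x∈Q)))) ] (compare p q)

  -- `below` is the largest set of the tower without `x`. Its extension contains `x`, since
  -- otherwise the extension would itself be part of `below`, together with its fresh point. By the
  -- two inequalities `y` also lies in the extension but not in `below`, so both points are the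
  -- fresh one.
  ≤-antisym : ∀ {x y} → x ≤ y → y ≤ x → x ≈ y
  ≤-antisym {x} {y} x≤y y≤x = by-cases (decide (x ∈ extend below))
    where
    F : Subset → Bool
    F P = does (decide (Tower P × ¬ (x ∈ P)))
    F⁻ : ∀ P → F P ≡ true → Tower P × ¬ (x ∈ P)
    F⁻ P P∈F with decide (Tower P × ¬ (x ∈ P))
    ... | yes p = p
    F⁻ P () | no _
    below : Subset
    below = ⋃ F
    tower : Tower below
    tower = union F λ P P∈F → proj₁ (F⁻ P P∈F)
    x∉below : ¬ (x ∈ below)
    x∉below x∈ with ∈⁻ (InUnion F) x∈
    ... | P , P∈F , x∈P = proj₂ (F⁻ P P∈F) x∈P
    fresh : ∀ {z} → ¬ (z ∈ below) → z ∈ extend below → IsFresh below z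
    fresh z∉ z∈ with ∈⁻ (InExtension below) z∈
    ... | inj₁ z∈below = ⊥-elim (z∉ z∈below)
    ... | inj₂ f       = f
    by-cases : Dec (x ∈ extend below) → x ≈ y
    by-cases (yes x∈) =
      IsFresh-unique below (fresh x∉below x∈)
        (fresh (λ y∈ → x∉below (x≤y below tower y∈)) (y≤x (extend below) (step tower) x∈))
    by-cases (no x∉) with IsFresh-exists below x∉below
    ... | z , z∉below , f =
      ⊥-elim (z∉below (⊆⋃ F (dec-true (decide _) (step tower , x∉)) z (∈⁺ (InExtension below) (inj₂ f))))

  ≤-isTotalOrder : IsTotalOrder _≈_ _≤_
  ≤-isTotalOrder = record
    { isPartialOrder = record
      { isPreorder = record
        { isEquivalence = isEquivalence
        ; reflexive     = λ x≈y P p → Tower-resp p (sym x≈y)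
        ; trans         = λ x≤y y≤z P p → x≤y P p ∘ y≤z P p
        }
      ; antisym = ≤-antisym
      }
    ; total = ≤-total
    }

  -- Canonical representatives of equivalence classes.

  choose : Subset → Carrier → Carrier
  choose P x with decide (∃[ z ] z ∈ P)
  ... | yes (z , _) = z
  ... | no _        = x

  choose-∈ : ∀ P {x} → x ∈ P → choose P x ∈ P
  choose-∈ P x∈P with decide (∃[ z ] z ∈ P)
  ... | yes (_ , z∈P) = z∈P
  ... | no _          = x∈P

  choose-irrelevant : ∀ P {x} y → x ∈ P → choose P x ≡ choose P y
  choose-irrelevant P y x∈P with decide (∃[ z ] z ∈ P)
  ... | yes _   = ≡.refl
  ... | no none = ⊥-elim (none (_ , x∈P))

  canonical : Carrier → Carrier
  canonical x = choose ⟪ _≈ x ⟫ x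

  canonical-≈ : ∀ x → canonical x ≈ x
  canonical-≈ x = ∈⁻ (_≈ x) (choose-∈ ⟪ _≈ x ⟫ (∈⁺ (_≈ x) (Setoid.refl X)))

  -- Equivalent points have the same class as a Boolean set by extensionality, and on a nonempty set
  -- `choose` ignores its default argument.
  canonical-cong : ∀ {x y} → x ≈ y → canonical x ≡ canonical y
  canonical-cong {x} {y} x≈y = ≡.trans
    (choose-irrelevant ⟪ _≈ x ⟫ y (∈⁺ (_≈ x) (Setoid.refl X)))
    (≡.cong (λ P → choose P y) (⊆-antisym
      (λ z z∈ → ∈⁺ (_≈ y) (trans (∈⁻ (_≈ x) z∈) x≈y))
      (λ z z∈ → ∈⁺ (_≈ x) (trans (∈⁻ (_≈ y) z∈) (sym x≈y)))))

-- Arithmetic in a Dedekind-complete ordered field.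

module _ (ℝ : RealField) (decide : ∀ (P : Set) → Dec P) where

  private
    module ℝ = RealField ℝ
    module H = HeytingField ℝ.heytingField
  open ℝ using (_≈_; _+_; _*_; -_; 0#; 1#; _<_; fromℕ; _≤_; isTotalOrder; +-monoˡ-≤; *-nonNeg)
  open CommutativeRing ℝ.commutativeRing
    using (refl; sym; trans; +-cong; +-congˡ; +-congʳ; +-assoc; +-comm; +-identityˡ; +-identityʳ;
           *-congˡ; *-congʳ; *-assoc; *-comm; *-identityˡ; *-identityʳ; distribˡ; distribʳ;
           zeroˡ; zeroʳ; -‿inverseˡ; -‿inverseʳ; commutativeSemiring)
  open IsTotalOrder isTotalOrder
    using () renaming (refl to ≤-refl; reflexive to ≤-reflexive; trans to ≤-trans;
                       antisym to ≤-antisym; total to ≤-total)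
  open NaturalSolver commutativeSemiring using (solve; con; _:+_; _:*_; _:=_)

  totalOrder : TotalOrder 0ℓ 0ℓ 0ℓ
  totalOrder = record { isTotalOrder = isTotalOrder }

  module ≤-Reasoning = PartialOrderReasoning (TotalOrder.poset totalOrder)

  +-mono-≤ : ∀ {x y u v} → x ≤ y → u ≤ v → x + u ≤ y + v
  +-mono-≤ {x} {y} {u} {v} x≤y u≤v = begin
    x + u ≤⟨ +-monoˡ-≤ u x≤y ⟩
    y + u ≈⟨ +-comm y u ⟩
    u + y ≤⟨ +-monoˡ-≤ y u≤v ⟩
    v + y ≈⟨ +-comm v y ⟩
    y + v ∎
    where open ≤-Reasoning

  +-cancelʳ-≤ : ∀ {x y} z → x + z ≤ y + z → x ≤ y
  +-cancelʳ-≤ {x} {y} z x+z≤y+z = begin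
    x               ≈⟨ undo x ⟨
    (x + z) + (- z) ≤⟨ +-monoˡ-≤ (- z) x+z≤y+z ⟩
    (y + z) + (- z) ≈⟨ undo y ⟩
    y               ∎
    where
    open ≤-Reasoning
    undo : ∀ t → (t + z) + (- z) ≈ t
    undo t = trans (+-assoc t z (- z)) (trans (+-congˡ (-‿inverseʳ z)) (+-identityʳ t))

  -- Inequalities are rearranged without subtraction, so that the side
  -- condition is a semiring identity.
  rearrange : ∀ {p q a b} → p + b ≈ q + a → a ≤ b → p ≤ q
  rearrange {p} {q} {a} {b} eq a≤b = +-cancelʳ-≤ b (begin
    p + b ≈⟨ eq ⟩
    q + a ≤⟨ +-mono-≤ ≤-refl a≤b ⟩
    q + b ∎)
    where open ≤-Reasoning

  x≤x+y : ∀ {x y} → 0# ≤ y → x ≤ x + y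
  x≤x+y {x} {y} 0≤y = ≤-trans (≤-reflexive (sym (+-identityʳ x))) (+-mono-≤ ≤-refl 0≤y)

  +-nonNeg : ∀ {x y} → 0# ≤ x → 0# ≤ y → 0# ≤ x + y
  +-nonNeg 0≤x 0≤y = ≤-trans 0≤x (x≤x+y 0≤y)

  -- Differences are introduced as an unknown summand, so that later identities stay within reach of
  -- the semiring solver.
  gap : ∀ x y → ∃[ t ] x + t ≈ y
  gap x y = (- x) + y , trans (sym (+-assoc x (- x) y)) (trans (+-congʳ (-‿inverseʳ x)) (+-identityˡ y))

  *-monoʳ-≤ : ∀ {x y} z → 0# ≤ z → x ≤ y → x * z ≤ y * z
  *-monoʳ-≤ {x} {y} z 0≤z x≤y with gap x y
  ... | t , x+t≈y = begin
    x * z         ≤⟨ x≤x+y (*-nonNeg 0≤t 0≤z) ⟩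
    x * z + t * z ≈⟨ distribʳ z x t ⟨
    (x + t) * z   ≈⟨ *-congʳ x+t≈y ⟩
    y * z         ∎
    where
    open ≤-Reasoning
    0≤t : 0# ≤ t
    0≤t = rearrange (trans (+-identityˡ y) (trans (sym x+t≈y) (+-comm x t))) x≤y

  *-monoˡ-≤ : ∀ {x y} z → 0# ≤ z → x ≤ y → z * x ≤ z * y
  *-monoˡ-≤ {x} {y} z 0≤z x≤y = begin
    z * x ≈⟨ *-comm z x ⟩
    x * z ≤⟨ *-monoʳ-≤ z 0≤z x≤y ⟩
    y * z ≈⟨ *-comm y z ⟩
    z * y ∎
    where open ≤-Reasoning

  ≰⇒> : ∀ {x y} → ¬ (x ≤ y) → y < x
  ≰⇒> {x} {y} x≰y with ≤-total x y
  ... | inj₁ x≤y = ⊥-elim (x≰y x≤y)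
  ... | inj₂ y≤x = y≤x , λ y≈x → x≰y (≤-reflexive (sym y≈x))

  <⇒≱ : ∀ {x y} → x < y → ¬ (y ≤ x)
  <⇒≱ (x≤y , x≉y) y≤x = x≉y (≤-antisym x≤y y≤x)

  ≮⇒≥ : ∀ {x y} → ¬ (x < y) → y ≤ x
  ≮⇒≥ {x} {y} x≮y with decide (y ≤ x)
  ... | yes y≤x = y≤x
  ... | no y≰x  = ⊥-elim (x≮y (≰⇒> y≰x))

  <-≤-trans : ∀ {x y z} → x < y → y ≤ z → x < z
  <-≤-trans x<y y≤z = ≰⇒> λ z≤x → <⇒≱ x<y (≤-trans y≤z z≤x)

  0≤1 : 0# ≤ 1#
  0≤1 with ≤-total 0# 1#
  ... | inj₁ 0≤1 = 0≤1
  -- Here `t` is minus one: it would be nonnegative, and its square is 1.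
  ... | inj₂ 1≤0 with gap 1# 0#
  ... | t , 1+t≈0 = begin
    0#    ≤⟨ *-nonNeg 0≤t 0≤t ⟩
    t * t ≈⟨ t*t≈1 ⟩
    1#    ∎
    where
    open ≤-Reasoning
    0≤t : 0# ≤ t
    0≤t = rearrange (trans (+-identityˡ 0#) (trans (sym 1+t≈0) (+-comm 1# t))) 1≤0
    t*t≈1 : t * t ≈ 1#
    t*t≈1 = begin-equality
      t * t                   ≈⟨ +-identityˡ (t * t) ⟨
      0# + t * t              ≈⟨ +-congʳ 1+t≈0 ⟨
      (1# + t) + t * t        ≈⟨ solve 1 (λ t → (con 1 :+ t) :+ t :* t := con 1 :+ t :* (con 1 :+ t)) refl t ⟩
      1# + t * (1# + t)       ≈⟨ +-congˡ (*-congˡ 1+t≈0) ⟩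
      1# + t * 0#             ≈⟨ +-congˡ (zeroʳ t) ⟩
      1# + 0#                 ≈⟨ +-identityʳ 1# ⟩
      1#                      ∎

  -- By tightness a nonzero element is apart from zero; the field axiom then inverts `x - 0#`.
  inverse : ∀ {x} → ¬ (x ≈ 0#) → ∃[ y ] x * y ≈ 1#
  inverse {x} x≉0 with decide (x ℝ.# 0#)
  ... | no ¬x#0 = ⊥-elim (x≉0 (proj₁ (ℝ.tight x 0#) ¬x#0))
  ... | yes x#0 with ℝ.#⇒invertible x#0
  ... | y , _ , [x-0]*y≈1 = y , trans (*-congʳ (trans (sym (+-identityʳ x)) (+-congˡ 0≈-0))) [x-0]*y≈1
    where
    0≈-0 : 0# ≈ - 0#
    0≈-0 = trans (sym (-‿inverseʳ 0#)) (+-identityˡ (- 0#))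

  -- If 0 and 1 were equal, all elements would be, so zero would be invertible and hence apart from
  -- itself.
  0<1 : 0# < 1#
  0<1 = 0≤1 , λ 0≈1 → H.#-irrefl refl (ℝ.invertible⇒# {0#} {0#} (0# , collapse 0≈1 _ , collapse 0≈1 _))
    where
    collapse : 0# ≈ 1# → ∀ x {y} → x ≈ y
    collapse 0≈1 x {y} = trans (≈0 x) (sym (≈0 y))
      where
      ≈0 : ∀ z → z ≈ 0#
      ≈0 z = trans (sym (*-identityʳ z)) (trans (*-congˡ (sym 0≈1)) (zeroʳ z))

  *-cancelʳ-≤ : ∀ {x y} z → 0# < z → x * z ≤ y * z → x ≤ y
  *-cancelʳ-≤ {x} {y} z (0≤z , 0≉z) xz≤yz with inverse (λ z≈0 → 0≉z (sym z≈0)) | ≤-total x y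
  ... | _             | inj₁ x≤y = x≤y
  ... | z⁻¹ , zz⁻¹≈1 | inj₂ y≤x = ≤-reflexive (begin-equality
    x             ≈⟨ undo x ⟨
    (x * z) * z⁻¹ ≈⟨ *-congʳ (≤-antisym xz≤yz (*-monoʳ-≤ z 0≤z y≤x)) ⟩
    (y * z) * z⁻¹ ≈⟨ undo y ⟩
    y             ∎)
    where
    open ≤-Reasoning
    undo : ∀ t → (t * z) * z⁻¹ ≈ t
    undo t = trans (*-assoc t z z⁻¹) (trans (*-congˡ zz⁻¹≈1) (*-identityʳ t))

  inverse-pos : ∀ {x y} → 0# < x → x * y ≈ 1# → 0# ≤ y
  inverse-pos {x} {y} 0<x xy≈1 = *-cancelʳ-≤ x 0<x (begin
    0# * x ≈⟨ zeroˡ x ⟩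
    0#     ≤⟨ 0≤1 ⟩
    1#     ≈⟨ xy≈1 ⟨
    x * y  ≈⟨ *-comm x y ⟩
    y * x  ∎)
    where open ≤-Reasoning

  reciprocal : ∀ {x} → 0# < x → ∃[ y ] 0# ≤ y × x * y ≈ 1#
  reciprocal 0<x with inverse (λ x≈0 → proj₂ 0<x (sym x≈0))
  ... | y , xy≈1 = y , inverse-pos 0<x xy≈1 , xy≈1

  fromℕ-nonNeg : ∀ n → 0# ≤ fromℕ n
  fromℕ-nonNeg ℕ.zero    = ≤-refl
  fromℕ-nonNeg (ℕ.suc n) = +-nonNeg 0≤1 (fromℕ-nonNeg n)

  fromℕ-mono : ∀ {m n} → m ℕ.≤ n → fromℕ m ≤ fromℕ n
  fromℕ-mono {n = n} z≤n       = fromℕ-nonNeg n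
  fromℕ-mono         (s≤s m≤n) = +-mono-≤ ≤-refl (fromℕ-mono m≤n)

  -- Otherwise `t`, which is `s` minus `ε`, would be a smaller upper bound.
  supremum-approx : ∀ {P : ℝ.Carrier → Set} {s ε} → IsSupremum _≤_ P s → 0# < ε →
                    ∃[ q ] P q × s ≤ q + ε
  supremum-approx {P} {s} {ε} (_ , least) 0<ε with decide (∃[ q ] P q × s ≤ q + ε)
  ... | yes found = found
  ... | no none with gap ε s
  ... | t , ε+t≈s = ⊥-elim (<⇒≱ 0<ε (rearrange
          (solve 2 (λ ε t → ε :+ t := con 0 :+ (ε :+ t)) refl ε t)
          (≤-trans (≤-reflexive ε+t≈s) (least t below))))
    where
    below : ∀ q → P q → q ≤ t
    below q Pq = +-cancelʳ-≤ ε (begin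
      q + ε ≤⟨ proj₁ (≰⇒> λ s≤q+ε → none (q , Pq , s≤q+ε)) ⟩
      s     ≈⟨ ε+t≈s ⟨
      ε + t ≈⟨ +-comm ε t ⟩
      t + ε ∎)
      where open ≤-Reasoning

  -- Path lengths and the order in which a path visits points.

  module _ (M : MetricSpace ℝ) where

    open MetricSpace M renaming (Carrier to Point; _≈_ to _≈ₘ_)
    private
      module M = IsGeneralMetric isMetric
      len : List Point → ℝ.Carrier
      len = pathLength M
    open Membership setoid using (_∈_)
    open ListEquality setoid using (_≋_; ≋-refl; ≋-trans)
    open Permutation setoid using (_↭_; ↭-refl; ↭-sym; ↭-trans; ↭-prep; ↭-swap)
    open PermutationProperties setoid
      using (∈-resp-↭; Unique-resp-↭; xs↭ys⇒|xs|≡|ys|; ++↭ʳ++; ↭-split; ¬x∷xs↭[]; ++-comm)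
    open UniqueSetoid setoid using (Unique)

    d-refl : ∀ {x y} → x ≈ₘ y → d x y ≈ 0#
    d-refl = M.≈⇒0

    d≤0 : ∀ {x y} → x ≈ₘ y → d x y ≤ 0#
    d≤0 x≈y = ≤-reflexive (d-refl x≈y)

    d-pos : ∀ {x y} → ¬ (x ≈ₘ y) → 0# < d x y
    d-pos x≉y = M.nonNegative , λ 0≈d → x≉y (M.0⇒≈ (sym 0≈d))

    d-congˡ : ∀ {x x′ y} → x ≈ₘ x′ → d x y ≈ d x′ y
    d-congˡ x≈x′ = M.cong x≈x′ M.EqC.refl

    d-flip : ∀ {x x′ y} → x ≈ₘ x′ → d y x ≈ d x′ y
    d-flip x≈x′ = trans (M.sym _ _) (d-congˡ x≈x′)

    pathLength-cong : ∀ {xs ys} → xs ≋ ys → len xs ≈ len ys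
    pathLength-cong []                     = refl
    pathLength-cong (_ ∷ [])               = refl
    pathLength-cong (x≈x′ ∷ y≈y′ ∷ xs≋ys) = +-cong (M.cong x≈x′ y≈y′) (pathLength-cong (y≈y′ ∷ xs≋ys))

    pathLength-nonNeg : ∀ xs → 0# ≤ len xs
    pathLength-nonNeg []           = ≤-refl
    pathLength-nonNeg (x ∷ [])     = ≤-refl
    pathLength-nonNeg (x ∷ y ∷ xs) = +-nonNeg M.nonNegative (pathLength-nonNeg (y ∷ xs))

    pathLength-tail : ∀ x xs → len xs ≤ len (x ∷ xs)
    pathLength-tail x []       = ≤-refl
    pathLength-tail x (y ∷ xs) = ≤-trans (x≤x+y M.nonNegative) (≤-reflexive (+-comm _ _))

    visits-one : ∀ {x v xs} → v ∈ x ∷ xs → d x v ≤ len (x ∷ xs)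
    visits-one {x} {xs = xs} (here v≈x) = ≤-trans (d≤0 (M.EqC.sym v≈x)) (pathLength-nonNeg (x ∷ xs))
    visits-one {x} {v} {y ∷ xs} (there v∈xs) =
      ≤-trans (M.triangle x y v) (+-mono-≤ ≤-refl (visits-one v∈xs))

    visits-two : ∀ {x v w xs} → v ∈ x ∷ xs → w ∈ x ∷ xs →
                 d x v + d v w ≤ len (x ∷ xs) ⊎ d x w + d w v ≤ len (x ∷ xs)
    visits-two {x} {v} {w} {xs} (here v≈x) w∈ = inj₁ (begin
      d x v + d v w ≈⟨ +-cong (d-refl (M.EqC.sym v≈x)) (M.cong v≈x M.EqC.refl) ⟩
      0# + d x w    ≈⟨ +-identityˡ _ ⟩
      d x w         ≤⟨ visits-one w∈ ⟩
      len (x ∷ xs)  ∎)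
      where open ≤-Reasoning
    visits-two {x} {v} {w} {xs} v∈@(there _) (here w≈x) = inj₂ (begin
      d x w + d w v ≈⟨ +-cong (d-refl (M.EqC.sym w≈x)) (M.cong w≈x M.EqC.refl) ⟩
      0# + d x v    ≈⟨ +-identityˡ _ ⟩
      d x v         ≤⟨ visits-one v∈ ⟩
      len (x ∷ xs)  ∎)
      where open ≤-Reasoning
    visits-two {x} {v} {w} {y ∷ xs} (there v∈) (there w∈) = Sum.map via via (visits-two v∈ w∈)
      where
      via : ∀ {u t} → d y u + t ≤ len (y ∷ xs) → d x u + t ≤ d x y + len (y ∷ xs)
      via p = ≤-trans (+-monoˡ-≤ _ (M.triangle x y _)) (≤-trans (≤-reflexive (+-assoc _ _ _)) (+-mono-≤ ≤-refl p))

    -- The three cases name the point visited between the other two. The two directions of travel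
    -- fall together by symmetry of `d`.
    visits-three : ∀ {u v w xs} → u ∈ xs → v ∈ xs → w ∈ xs →
                   d u v + d v w ≤ len xs ⊎ d v u + d u w ≤ len xs ⊎ d u w + d w v ≤ len xs
    visits-three {xs = x ∷ xs} (there u∈) (there v∈) (there w∈) =
      Sum.map weaken (Sum.map weaken weaken) (visits-three u∈ v∈ w∈)
      where
      weaken : ∀ {t} → t ≤ len xs → t ≤ len (x ∷ xs)
      weaken p = ≤-trans p (pathLength-tail x xs)
    visits-three (here u≈x) v∈ w∈ with visits-two v∈ w∈
    ... | inj₁ p = inj₁ (≤-trans (≤-reflexive (+-congʳ (d-congˡ u≈x))) p)
    ... | inj₂ p = inj₂ (inj₂ (≤-trans (≤-reflexive (+-congʳ (d-congˡ u≈x))) p))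
    visits-three u∈@(there _) (here v≈x) w∈ with visits-two u∈ w∈
    ... | inj₁ p = inj₂ (inj₁ (≤-trans (≤-reflexive (+-congʳ (d-congˡ v≈x))) p))
    ... | inj₂ p = inj₂ (inj₂ (≤-trans (≤-reflexive (trans (+-comm _ _) (+-cong (d-flip v≈x) (M.sym _ _)))) p))
    visits-three u∈@(there _) v∈@(there _) (here w≈x) with visits-two u∈ v∈
    ... | inj₁ p = inj₂ (inj₁ (≤-trans (≤-reflexive (trans (+-comm _ _) (+-cong (d-flip w≈x) (M.sym _ _)))) p))
    ... | inj₂ p = inj₁ (≤-trans (≤-reflexive (trans (+-comm _ _) (+-cong (d-flip w≈x) (M.sym _ _)))) p)

    d≤pathLength : ∀ {u v xs} → u ∈ xs → v ∈ xs → d u v ≤ len xs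
    d≤pathLength (here u≈x) v∈ = ≤-trans (≤-reflexive (d-congˡ u≈x)) (visits-one v∈)
    d≤pathLength u∈@(there _) (here v≈x) = ≤-trans (≤-reflexive (d-flip v≈x)) (visits-one u∈)
    d≤pathLength {xs = x ∷ xs} (there u∈) (there v∈) = ≤-trans (d≤pathLength u∈ v∈) (pathLength-tail x xs)

    -- Paths with bounded edges.

    module _ {R : Rel Point 0ℓ} where

      Linked-fromMembers : ∀ xs → (∀ {u v} → u ∈ xs → v ∈ xs → R u v) → Linked R xs
      Linked-fromMembers []           r = []
      Linked-fromMembers (x ∷ [])     r = [-]
      Linked-fromMembers (x ∷ y ∷ xs) r =
        r (here M.EqC.refl) (there (here M.EqC.refl)) ∷ 
        Linked-fromMembers (y ∷ xs) λ u∈ v∈ → r (there u∈) (there v∈)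

    pathLength-bounded : ∀ {L k} → 0# ≤ L → ∀ {xs} → Linked (λ x y → d x y ≤ L) xs →
                         length xs ℕ.≤ ℕ.suc k → len xs ≤ fromℕ k * L
    pathLength-bounded {k = k} 0≤L []  _ = *-nonNeg (fromℕ-nonNeg k) 0≤L
    pathLength-bounded {k = k} 0≤L [-] _ = *-nonNeg (fromℕ-nonNeg k) 0≤L
    pathLength-bounded {L} {ℕ.suc k} 0≤L {x ∷ y ∷ xs} (dxy≤L ∷ ds) (s≤s |xs|≤k) = begin
      d x y + len (y ∷ xs)  ≤⟨ +-mono-≤ dxy≤L (pathLength-bounded 0≤L ds |xs|≤k) ⟩
      L + fromℕ k * L       ≈⟨ solve 2 (λ l k → l :+ k :* l := (con 1 :+ k) :* l) refl L (fromℕ k) ⟩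
      fromℕ (ℕ.suc k) * L   ∎
      where open ≤-Reasoning

    -- Compared with `k` edges of length `L` the path falls short by at most `e` in total, and no
    -- edge exceeds `L`. Hence no single edge falls short by more than `e`, and a missing edge,
    -- costing `L`, is impossible.
    nearly-extremal : ∀ {L e k} → 0# ≤ L → e < L → ∀ x xs → Linked (λ x y → d x y ≤ L) (x ∷ xs) →
                      length xs ℕ.≤ k → fromℕ k * L ≤ len (x ∷ xs) + e →
                      length xs ≡ k × Linked (λ x y → L ≤ d x y + e) (x ∷ xs)
    nearly-extremal {k = ℕ.zero} 0≤L e<L x [] ds _ _ = ≡.refl , [-]
    nearly-extremal {L} {e} {ℕ.suc k} 0≤L e<L x [] ds _ long = ⊥-elim (<⇒≱ e<L (begin
      L                    ≤⟨ x≤x+y (*-nonNeg (fromℕ-nonNeg k) 0≤L) ⟩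
      L + fromℕ k * L      ≈⟨ solve 2 (λ l k → l :+ k :* l := (con 1 :+ k) :* l) refl L (fromℕ k) ⟩
      fromℕ (ℕ.suc k) * L  ≤⟨ long ⟩
      0# + e               ≈⟨ +-identityˡ e ⟩
      e                    ∎))
      where open ≤-Reasoning
    nearly-extremal {L} {e} {ℕ.suc k} 0≤L e<L x (y ∷ xs) (dxy≤L ∷ ds) (s≤s |xs|≤k) long
      with nearly-extremal {k = k} 0≤L e<L y xs ds |xs|≤k
             (rearrange (solve 5 (λ k l p e d → k :* l :+ ((d :+ p :+ e) :+ l) := (p :+ e) :+ ((con 1 :+ k) :* l :+ d))
                          refl (fromℕ k) L (len (y ∷ xs)) e (d x y))
                (+-mono-≤ long dxy≤L))
    ... | |xs|≡k , es = ≡.cong ℕ.suc |xs|≡k ,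
        rearrange (solve 5 (λ k l p e d → l :+ ((d :+ p :+ e) :+ k :* l) := (d :+ e) :+ ((con 1 :+ k) :* l :+ p))
                      refl (fromℕ k) L (len (y ∷ xs)) e (d x y))
          (+-mono-≤ long (pathLength-bounded 0≤L ds (s≤s |xs|≤k))) ∷ es

    -- Finite lists of permutations and the existence of optimal lengths.

    insertions : Point → List Point → List (List Point)
    insertions x []       = (x ∷ []) ∷ []
    insertions x (z ∷ zs) = (x ∷ z ∷ zs) ∷ map (z ∷_) (insertions x zs)

    insertions-↭ : ∀ x zs → All (_↭ x ∷ zs) (insertions x zs)
    insertions-↭ x []       = ↭-refl ∷ []
    insertions-↭ x (z ∷ zs) =
      ↭-refl ∷ All.map⁺ (All.map (λ p → ↭-trans (↭-prep z p) (↭-swap z x ↭-refl)) (insertions-↭ x zs))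

    insertions-complete : ∀ x as bs zs → as ++ bs ≋ zs → Any (as ++ x ∷ bs ≋_) (insertions x zs)
    insertions-complete x []       []       []       []               = here ≋-refl
    insertions-complete x []       (b ∷ bs) (z ∷ zs) p                = here (M.EqC.refl ∷ p)
    insertions-complete x (a ∷ as) bs       (z ∷ zs) (a≈z ∷ p) =
      there (Any.map⁺ (Any.map (a≈z ∷_) (insertions-complete x as bs zs p)))

    permutations : List Point → List (List Point)
    permutations []       = [] ∷ []
    permutations (x ∷ xs) = concatMap (insertions x) (permutations xs)

    permutations-↭ : ∀ xs → All (_↭ xs) (permutations xs)
    permutations-↭ []       = ↭-refl ∷ []
    permutations-↭ (x ∷ xs) = All.concat⁺ (All.map⁺ (All.map step (permutations-↭ xs)))
      where
      step : ∀ {zs} → zs ↭ xs → All (_↭ x ∷ xs) (insertions x zs)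
      step {zs} zs↭xs = All.map (λ p → ↭-trans p (↭-prep x zs↭xs)) (insertions-↭ x zs)

    permutations-complete : ∀ xs ys → ys ↭ xs → Any (ys ≋_) (permutations xs)
    permutations-complete []       []       _ = here []
    permutations-complete []       (y ∷ ys) p = ⊥-elim (¬x∷xs↭[] p)
    permutations-complete (x ∷ xs) ys       p with ↭-split x [] xs p
    ... | as , bs , ys≋ , as++bs↭ =
      Any.concat⁺ (Any.map⁺ (Any.map step (permutations-complete xs (as ++ bs) (↭-trans as++bs↭ ↭-refl))))
      where
      step : ∀ {zs} → as ++ bs ≋ zs → Any (ys ≋_) (insertions x zs)
      step {zs} q = Any.map (≋-trans ys≋) (insertions-complete x as bs zs q)

    -- The minimum is taken over a finite list that contains every enumeration up to pointwise
    -- equivalence, under which lengths are invariant.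
    OptLength-exists : ∀ xs → ∃[ l ] OptLength M xs l
    OptLength-exists xs =
      len best , (best , best↭xs , refl) , λ { l (ys , ys↭xs , eq) → ≤-trans (best≤ ys↭xs) (≤-reflexive eq) }
      where
      open Extrema totalOrder using (argmin; argmin-all; f[argmin]≤v⁺)
      best : List Point
      -- The start value `xs` of the search is itself an enumeration, so it is a legitimate
      -- minimiser.
      best = argmin len xs (permutations xs)
      best↭xs : best ↭ xs
      best↭xs = argmin-all len ↭-refl (permutations-↭ xs)
      best≤ : ∀ {ys} → ys ↭ xs → len best ≤ len ys
      best≤ {ys} ys↭xs = f[argmin]≤v⁺ xs (permutations xs)
        (inj₂ (Any.map (λ ys≋zs → ≤-reflexive (sym (pathLength-cong ys≋zs))) (permutations-complete xs ys ys↭xs)))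

    -- Paths alternating between two clusters.

    module _ {R S : Rel Point 0ℓ} where

      SkipLinked-fromMembers : ∀ {xs} → Linked R xs →
                               (∀ {x y z} → x ∈ xs → y ∈ xs → z ∈ xs → R x y → R y z → S x z) →
                               SkipLinked S xs
      SkipLinked-fromMembers []        _ = []
      SkipLinked-fromMembers [-]       _ = [-]
      SkipLinked-fromMembers (_ ∷ [-]) _ = [-,-]
      SkipLinked-fromMembers (Rxy ∷ Rs@(Ryz ∷ _)) s =
        s (here M.EqC.refl) (there (here M.EqC.refl)) (there (there (here M.EqC.refl))) Rxy Ryz ∷
        SkipLinked-fromMembers Rs (λ x∈ y∈ z∈ → s (there x∈) (there y∈) (there z∈))

    odds++evens-↭ : ∀ xs → odds xs ++ evens xs ↭ xs
    odds++evens-↭ []       = ↭-refl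
    odds++evens-↭ (x ∷ xs) = ↭-prep x (↭-trans (++-comm (evens xs) (odds xs)) (odds++evens-↭ xs))

    -- Reversing the first list brings the two heads together, so the connecting edge is `d x y`.
    pathLength-ʳ++ : ∀ x xs y ys → len ((x ∷ xs) ʳ++ (y ∷ ys)) ≈ len (x ∷ xs) + (d x y + len (y ∷ ys))
    pathLength-ʳ++ x []        y ys = sym (+-identityˡ _)
    pathLength-ʳ++ x (x′ ∷ xs) y ys = begin-equality
      len ((x′ ∷ xs) ʳ++ (x ∷ y ∷ ys))                    ≈⟨ pathLength-ʳ++ x′ xs x (y ∷ ys) ⟩
      len (x′ ∷ xs) + (d x′ x + (d x y + len (y ∷ ys)))   ≈⟨ +-assoc _ _ _ ⟨
      (len (x′ ∷ xs) + d x′ x) + (d x y + len (y ∷ ys))   ≈⟨ +-congʳ (trans (+-comm _ _) (+-congʳ (M.sym x′ x))) ⟩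
      (d x x′ + len (x′ ∷ xs)) + (d x y + len (y ∷ ys))   ∎
      where open ≤-Reasoning

    -- The edges of the two sublists are the pairs two places apart. Counting as many of them as
    -- points is too generous by at most two.
    odds-evens-length : ∀ {w} → 0# ≤ w → ∀ {xs} → SkipLinked (λ x z → d x z ≤ w) xs →
                        len (odds xs) + len (evens xs) ≤ fromℕ (length xs) * w
    odds-evens-length {w} 0≤w {xs} = go
      where
      short : ∀ n → 0# + 0# ≤ fromℕ n * w
      short n = ≤-trans (≤-reflexive (+-identityˡ 0#)) (*-nonNeg (fromℕ-nonNeg n) 0≤w)
      go : ∀ {xs} → SkipLinked (λ x z → d x z ≤ w) xs → len (odds xs) + len (evens xs) ≤ fromℕ (length xs) * w
      go []    = short 0
      go [-]   = short 1
      go [-,-] = short 2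
      go (_∷_ {x} {y} {z} {zs} dxz≤w ss) = begin
        (d x z + o) + e          ≈⟨ solve 3 (λ a o e → (a :+ o) :+ e := a :+ (e :+ o)) refl (d x z) o e ⟩
        d x z + (e + o)          ≤⟨ +-mono-≤ dxz≤w (go ss) ⟩
        w + n * w                ≈⟨ solve 2 (λ w n → w :+ n :* w := (con 1 :+ n) :* w) refl w n ⟩
        (1# + n) * w             ∎
        where
        open ≤-Reasoning
        o = len (odds (z ∷ zs))
        e = len (odds (y ∷ z ∷ zs))
        n = fromℕ (length (y ∷ z ∷ zs))

    -- By the triangle inequality each edge is shorter than its predecessor by at most `w`. With `k`
    -- edges the accumulated loss against the first edge is at most `k * k` times `w`, a crude
    -- bound.
    edges-lower-bound : ∀ {w} → 0# ≤ w → ∀ x y zs → SkipLinked (λ x z → d x z ≤ w) (x ∷ y ∷ zs) →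
                        let k = fromℕ (ℕ.suc (length zs)) in k * d x y ≤ len (x ∷ y ∷ zs) + (k * k) * w
    edges-lower-bound {w} 0≤w x y [] _ = begin
      (1# + 0#) * d x y              ≈⟨ trans (*-congʳ (+-identityʳ 1#)) (*-identityˡ _) ⟩
      d x y                          ≈⟨ +-identityʳ _ ⟨
      d x y + 0#                     ≤⟨ x≤x+y (*-nonNeg (*-nonNeg (fromℕ-nonNeg 1) (fromℕ-nonNeg 1)) 0≤w) ⟩
      d x y + 0# + (1# + 0#) * (1# + 0#) * w ∎
      where open ≤-Reasoning
    edges-lower-bound {w} 0≤w x y (z ∷ zs) (dxz≤w ∷ ss) = begin
      (1# + k) * a
        ≈⟨ solve 2 (λ k a → (con 1 :+ k) :* a := a :+ k :* a)
             refl k a ⟩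
      a + k * a                                       ≤⟨ +-mono-≤ ≤-refl (*-monoˡ-≤ k 0≤k a≤w+b) ⟩
      a + k * (w + d y z)
        ≈⟨ solve 4 (λ a k w b → a :+ k :* (w :+ b) := (a :+ k :* w) :+ k :* b)
             refl a k w (d y z) ⟩
      (a + k * w) + k * d y z                         ≤⟨ +-mono-≤ ≤-refl (edges-lower-bound 0≤w y z zs ss) ⟩
      -- The added summand completes the square of `1# + k`.
      (a + k * w) + (p + (k * k) * w)                 ≤⟨ x≤x+y (*-nonNeg (+-nonNeg 0≤1 0≤k) 0≤w) ⟩
      (a + k * w) + (p + (k * k) * w) + (1# + k) * w
        ≈⟨ solve 4 (λ a k w p → (a :+ k :* w) :+ (p :+ (k :* k) :* w) :+ (con 1 :+ k) :* w
                             := (a :+ p) :+ ((con 1 :+ k) :* (con 1 :+ k)) :* w)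
             refl a k w p ⟩
      (a + p) + ((1# + k) * (1# + k)) * w             ∎
      where
      open ≤-Reasoning
      a = d x y
      k = fromℕ (ℕ.suc (length zs))
      p = len (y ∷ z ∷ zs)
      0≤k : 0# ≤ k
      0≤k = fromℕ-nonNeg (ℕ.suc (length zs))
      a≤w+b : a ≤ w + d y z
      a≤w+b = ≤-trans (M.triangle x z y) (+-mono-≤ dxz≤w (≤-reflexive (M.sym z y)))

    -- Bounds for order ratios.

    d≤OptLength : ∀ {xs l u v} → OptLength M xs l → u ∈ xs → v ∈ xs → d u v ≤ l
    d≤OptLength ((ys , ys↭xs , |ys|≈l) , _) u∈ v∈ =
      ≤-trans (d≤pathLength (∈-resp-↭ (↭-sym ys↭xs) u∈) (∈-resp-↭ (↭-sym ys↭xs) v∈)) (≤-reflexive |ys|≈l)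

    OptLength-pos : ∀ {xs l} → Unique xs → 2 ℕ.≤ length xs → OptLength M xs l → 0# < l
    OptLength-pos {x ∷ y ∷ xs} ((x≉y ∷ _) ∷ _) _ opt =
      <-≤-trans (d-pos x≉y) (d≤OptLength opt (here M.EqC.refl) (there (here M.EqC.refl)))
    OptLength-pos {x ∷ []} _ (s≤s ())

    module _ (T : Order M) where

      open SortedTotalOrder (Order.totalOrder T) using (Sorted)

      OrderRatio-sorted : ∀ {k xs} → Unique xs → Sorted xs → 2 ℕ.≤ length xs → length xs ℕ.≤ ℕ.suc k →
                          ∃[ q ] ∃[ l ] OptLength M xs l × 0# < l × q * l ≈ len xs × OrderRatio M T k q
      OrderRatio-sorted {xs = xs} unique sorted 2≤ ≤k+1 with OptLength-exists xs
      ... | l , opt with OptLength-pos unique 2≤ opt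
      ... | 0<l with reciprocal 0<l
      ... | l⁻¹ , _ , ll⁻¹≈1 =
        len xs * l⁻¹ , l , opt , 0<l , ql≈len ,
        (xs , unique , 2≤ , ≤k+1 , len xs , l , (xs , ↭-refl , sorted , refl) , opt , ql≈len)
        where
        ql≈len : (len xs * l⁻¹) * l ≈ len xs
        ql≈len = trans (*-assoc _ _ _) (trans (*-congˡ (trans (*-comm _ _) ll⁻¹≈1)) (*-identityʳ _))

      -- The ordered path has at most `k` edges, and each joins two points that a shortest path also
      -- visits, so it is at most `lᵒ`.
      OrderRatio≤k : ∀ {k q} → OrderRatio M T k q → q ≤ fromℕ k
      OrderRatio≤k {k} {q} (xs , unique , 2≤ , ≤k+1 , lᵀ , lᵒ , (ys , ys↭xs , _ , |ys|≈lᵀ) , opt , qlᵒ≈lᵀ) =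
        *-cancelʳ-≤ lᵒ 0<lᵒ (begin
          q * lᵒ       ≈⟨ qlᵒ≈lᵀ ⟩
          lᵀ           ≈⟨ |ys|≈lᵀ ⟨
          len ys       ≤⟨ pathLength-bounded (proj₁ 0<lᵒ) edges |ys|≤k+1 ⟩
          fromℕ k * lᵒ ∎)
        where
        open ≤-Reasoning
        0<lᵒ : 0# < lᵒ
        0<lᵒ = OptLength-pos unique 2≤ opt
        |ys|≤k+1 : length ys ℕ.≤ ℕ.suc k
        |ys|≤k+1 = ≡.subst (ℕ._≤ ℕ.suc k) (≡.sym (xs↭ys⇒|xs|≡|ys| ys↭xs)) ≤k+1
        edges : Linked (λ x y → d x y ≤ lᵒ) ys
        edges = Linked-fromMembers ys λ u∈ v∈ → d≤OptLength opt (∈-resp-↭ ys↭xs u∈) (∈-resp-↭ ys↭xs v∈)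

      1≤OrderRatio : ∀ {k q} → OrderRatio M T k q → 1# ≤ q
      1≤OrderRatio {q = q} (xs , unique , 2≤ , _ , lᵀ , lᵒ , (ys , ys↭xs , _ , |ys|≈lᵀ) , opt , qlᵒ≈lᵀ) =
        *-cancelʳ-≤ lᵒ (OptLength-pos unique 2≤ opt) (begin
          1# * lᵒ  ≈⟨ *-identityˡ lᵒ ⟩
          lᵒ       ≤⟨ proj₂ opt lᵀ (ys , ys↭xs , |ys|≈lᵀ) ⟩
          lᵀ       ≈⟨ qlᵒ≈lᵀ ⟨
          q * lᵒ   ∎)
        where open ≤-Reasoning

      OrderRatio-inhabited : ∀ {k} → 1 ℕ.≤ k → HasTwoPoints M → ∃[ q ] OrderRatio M T k q
      OrderRatio-inhabited {k} 1≤k (x , y , x≉y) =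
        Sum.[ pair x≉y , pair (λ y≈x → x≉y (M.EqC.sym y≈x)) ]′ (IsTotalOrder.total (Order.isTotalOrder T) x y)
        where
        pair : ∀ {x y} → ¬ (x ≈ₘ y) → Order._≤_ T x y → ∃[ q ] OrderRatio M T k q
        pair x≉y x≤y =
          let q , _ , _ , _ , _ , ratio =
                OrderRatio-sorted ((x≉y ∷ []) ∷ [] ∷ []) (x≤y ∷ [-]) (s≤s (s≤s z≤n)) (s≤s 1≤k)
          in q , ratio

      ORᵀ-exists : ∀ {k} → 1 ℕ.≤ k → ∃[ r ] ORᵀ M T k r
      ORᵀ-exists {k} 1≤k with decide (HasTwoPoints M)
      ... | no ¬two = 1# , trivial ¬two refl
      ... | yes two with ℝ.complete (OrderRatio M T k) (OrderRatio-inhabited 1≤k two) (fromℕ k , λ _ → OrderRatio≤k)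
      ... | r , isSup = r , sup two isSup

      ORᵀ≤k : ∀ {k r} → 1 ℕ.≤ k → ORᵀ M T k r → r ≤ fromℕ k
      ORᵀ≤k _ (sup _ (_ , least)) = least _ λ _ → OrderRatio≤k
      ORᵀ≤k {k} 1≤k (trivial _ r≈1) = ≤-trans (≤-reflexive (trans r≈1 (sym (+-identityʳ 1#)))) (fromℕ-mono 1≤k)

    -- Snakes and large order ratios.

    -- The points of odd and of even index form two clusters of diameter O(w) at
    -- distance at least K w.
    Snake : Order M → ℕ → ℝ.Carrier → ℝ.Carrier → Set
    Snake T k K w =
      ∃[ xs ] length xs ≡ ℕ.suc k × Unique xs × Sorted xs ×
      Linked (λ x y → K * w ≤ d x y) xs × SkipLinked (λ x z → d x z ≤ w) xs
      where open SortedTotalOrder (Order.totalOrder T) using (Sorted)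

    -- Of three points on a path of length l, the middle one is not y, so that
    -- d x z is at most the excess of l over d x y or over d y z.
    excess-bound : ∀ {bs l e x y z} → len bs ≤ l → e + e < l → x ∈ bs → y ∈ bs → z ∈ bs →
                   l ≤ d x y + e → l ≤ d y z + e → d x z ≤ e
    excess-bound {bs} {l} {e} {x} {y} {z} short 2e<l x∈ y∈ z∈ l≤xy l≤yz with visits-three x∈ y∈ z∈
    ... | inj₁ p = ⊥-elim (<⇒≱ 2e<l (rearrange
            (solve 4 (λ l e a b → l :+ ((a :+ e) :+ (b :+ e) :+ l) := (e :+ e) :+ (l :+ l :+ (a :+ b)))
               refl l e (d x y) (d y z))
            (+-mono-≤ (+-mono-≤ l≤xy l≤yz) (≤-trans p short))))
    ... | inj₂ (inj₁ p) = rearrange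
            (solve 4 (λ l e a b → b :+ ((a :+ e) :+ l) := e :+ (l :+ (a :+ b))) refl l e (d x y) (d x z))
            (+-mono-≤ l≤xy (≤-trans (≤-reflexive (+-congʳ (M.sym x y))) (≤-trans p short)))
    ... | inj₂ (inj₂ p) = rearrange
            (solve 4 (λ l e a b → b :+ ((a :+ e) :+ l) := e :+ (l :+ (b :+ a))) refl l e (d y z) (d x z))
            (+-mono-≤ l≤yz (≤-trans (≤-reflexive (+-congˡ (M.sym y z))) (≤-trans p short)))

    -- With `ε` the reciprocal of `1# + K` and `e = ε * l`, one has `l ≈ e + K * e`. A ratio within
    -- `ε` of `r` gives an ordered path of length at least `k` times `l` minus `e`, so its edges are
    -- at least `l` minus `e`, that is `K * e`, and `excess-bound` puts points two steps apart
    -- within `e`.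
    ratio⇒snake : ∀ {T k r K} → IsSupremum _≤_ (OrderRatio M T k) r → fromℕ k ≤ r → fromℕ 2 ≤ K →
                  ∃[ w ] Snake T k K w
    ratio⇒snake {T} {k} {r} {K} isSup k≤r 2≤K with reciprocal 0<1+K
      where
      0<1+K : 0# < 1# + K
      0<1+K = <-≤-trans 0<1 (x≤x+y (≤-trans (fromℕ-nonNeg 2) 2≤K))
    ... | ε , 0≤ε , [1+K]ε≈1 with supremum-approx isSup (0≤ε , ε≉0)
      where
      ε≉0 : ¬ (0# ≈ ε)
      ε≉0 0≈ε = proj₂ 0<1 (trans (sym (zeroʳ (1# + K))) (trans (*-congˡ 0≈ε) [1+K]ε≈1))
    ... | q , (xs , unique , 2≤|xs| , |xs|≤k+1 , lᵀ , l , (x ∷ ys , ys↭xs , sorted , |ys|≈lᵀ) ,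
          opt@((bs , bs↭xs , |bs|≈l) , _) , ql≈lᵀ) , r≤q+ε =
      e , x ∷ ys , ≡.cong ℕ.suc (proj₁ extremal) , Unique-resp-↭ (↭-sym ys↭xs) unique , sorted ,
      Linked.map Ke≤d (proj₂ extremal) ,
      SkipLinked-fromMembers (proj₂ extremal) λ u∈ v∈ w∈ →
        excess-bound (≤-reflexive |bs|≈l) 2e<l (on-bs u∈) (on-bs v∈) (on-bs w∈)
      where
      open ≤-Reasoning
      e = ε * l
      0<l : 0# < l
      0<l = OptLength-pos unique 2≤|xs| opt
      0≤e : 0# ≤ e
      0≤e = *-nonNeg 0≤ε (proj₁ 0<l)
      e+Ke≈l : e + K * e ≈ l
      e+Ke≈l = begin-equality
        ε * l + K * (ε * l)
          ≈⟨ solve 3 (λ ε l K → ε :* l :+ K :* (ε :* l) := ((con 1 :+ K) :* ε) :* l)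
               refl ε l K ⟩
        ((1# + K) * ε) * l   ≈⟨ *-congʳ [1+K]ε≈1 ⟩
        1# * l               ≈⟨ *-identityˡ l ⟩
        l                    ∎
      3e≤l : e + (e + e) ≤ l
      3e≤l = begin
        e + (e + e)       ≈⟨ solve 1 (λ e → e :+ (e :+ e) := e :+ (con 1 :+ (con 1 :+ con 0)) :* e) refl e ⟩
        e + fromℕ 2 * e   ≤⟨ +-mono-≤ ≤-refl (*-monoʳ-≤ e 0≤e 2≤K) ⟩
        e + K * e         ≈⟨ e+Ke≈l ⟩
        l                 ∎
      -- `2 ≤ K` leaves room for three copies of `e` in `l`; if two already filled it, `e` and then
      -- `l` would not be positive.
      2e<l : e + e < l
      2e<l = ≰⇒> λ l≤2e → <⇒≱ 0<l (begin
        l             ≤⟨ l≤2e ⟩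
        e + e         ≤⟨ +-mono-≤ (e≤0 l≤2e) (e≤0 l≤2e) ⟩
        0# + 0#       ≈⟨ +-identityʳ 0# ⟩
        0#            ∎)
        where
        e≤0 : l ≤ e + e → e ≤ 0#
        e≤0 l≤2e = +-cancelʳ-≤ (e + e) (≤-trans 3e≤l (≤-trans l≤2e (≤-reflexive (sym (+-identityˡ _)))))
      e<l : e < l
      e<l = ≰⇒> λ l≤e → <⇒≱ 2e<l (≤-trans l≤e (x≤x+y 0≤e))
      on-bs : ∀ {u} → u ∈ x ∷ ys → u ∈ bs
      on-bs u∈ = ∈-resp-↭ (↭-sym bs↭xs) (∈-resp-↭ ys↭xs u∈)
      kl≤ : fromℕ k * l ≤ len (x ∷ ys) + e
      kl≤ = begin
        fromℕ k * l          ≤⟨ *-monoʳ-≤ l (proj₁ 0<l) (≤-trans k≤r r≤q+ε) ⟩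
        (q + ε) * l          ≈⟨ distribʳ l q ε ⟩
        q * l + e            ≈⟨ +-congʳ (trans ql≈lᵀ (sym |ys|≈lᵀ)) ⟩
        len (x ∷ ys) + e     ∎
      extremal : length ys ≡ k × Linked (λ x y → l ≤ d x y + e) (x ∷ ys)
      extremal = nearly-extremal (proj₁ 0<l) e<l x ys
        (Linked-fromMembers (x ∷ ys) λ u∈ v∈ → d≤OptLength opt (∈-resp-↭ ys↭xs u∈) (∈-resp-↭ ys↭xs v∈))
        (ℕ.s≤s⁻¹ (≡.subst (ℕ._≤ ℕ.suc k) (≡.sym (xs↭ys⇒|xs|≡|ys| ys↭xs)) |xs|≤k+1)) kl≤
      Ke≤d : ∀ {u v} → l ≤ d u v + e → K * e ≤ d u v
      Ke≤d {u} {v} l≤d+e = +-cancelʳ-≤ e (≤-trans (≤-reflexive (trans (+-comm _ _) e+Ke≈l)) l≤d+e)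
    ratio⇒snake _ _ _ | _ | _ , (_ , _ , 2≤|xs| , _ , _ , _ , ([] , ys↭xs , _) , _) , _
      with ≡.subst (2 ℕ.≤_) (≡.sym (xs↭ys⇒|xs|≡|ys| ys↭xs)) 2≤|xs|
    ... | ()

    -- The first and third points serve. In a uniformly discrete space this bounds `w` from below.
    snake-diam : ∀ {T k K w} → 2 ℕ.≤ k → Snake T k K w → ∃[ x ] ∃[ z ] ¬ (x ≈ₘ z) × d x z ≤ w
    snake-diam _ (x ∷ _ ∷ z ∷ _ , _ , (_ ∷ x≉z ∷ _) ∷ _ , _ , _ , dxz≤w ∷ _) = x , z , x≉z , dxz≤w
    snake-diam (s≤s ()) (_ ∷ _ ∷ [] , ≡.refl , _)
    snake-diam () (_ ∷ [] , ≡.refl , _)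

    -- `a` is the first edge. The ordered path is at least `c * a` minus `(c * c) * w` long, an
    -- optimal path at most `a + (1# + c) * w`, and `r` bounds the quotient.
    snake-bound : ∀ {T k K w r} → 1 ℕ.≤ k → Snake T k K w → 0# ≤ w → IsUpperBound _≤_ (OrderRatio M T k) r →
                  let c = fromℕ k in
                  ∃[ a ] K * w ≤ a × c * a ≤ r * (a + (1# + c) * w) + (c * c) * w
    snake-bound {T} {k} {K} {w} {r} _ (xs@(x ∷ y ∷ zs) , ≡.refl , unique , sorted , Kw≤ ∷ _ , skips) 0≤w upper
      with OrderRatio-sorted T unique sorted (s≤s (s≤s z≤n)) ℕ.≤-refl
    ... | q , l , opt , 0<l , ql≈len , ratio = d x y , Kw≤ , (begin
      c * d x y                                       ≤⟨ edges-lower-bound 0≤w x y zs skips ⟩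
      len xs + (c * c) * w                            ≈⟨ +-congʳ ql≈len ⟨
      q * l + (c * c) * w                             ≤⟨ +-monoˡ-≤ _ (*-monoʳ-≤ l (proj₁ 0<l) (upper q ratio)) ⟩
      r * l + (c * c) * w                             ≤⟨ +-monoˡ-≤ _ (*-monoˡ-≤ r 0≤r l≤) ⟩
      r * (d x y + (1# + c) * w) + (c * c) * w        ∎)
      where
      open ≤-Reasoning
      c = fromℕ (ℕ.suc (length zs))
      0≤r : 0# ≤ r
      0≤r = ≤-trans (*-cancelʳ-≤ l 0<l (begin
        0# * l  ≈⟨ zeroˡ l ⟩
        0#      ≤⟨ pathLength-nonNeg xs ⟩
        len xs  ≈⟨ ql≈len ⟨
        q * l   ∎)) (upper q ratio)
      -- The competing path runs backwards through one cluster, crosses from x to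
      -- y and continues through the other.
      weave↭xs : odds xs ʳ++ evens xs ↭ xs
      weave↭xs = ↭-trans (↭-sym (++↭ʳ++ (odds xs) (evens xs))) (odds++evens-↭ xs)
      l≤ : l ≤ d x y + (1# + c) * w
      l≤ = begin
        l                                                     ≤⟨ proj₂ opt _ (_ , weave↭xs , refl) ⟩
        len (odds xs ʳ++ evens xs)                            ≈⟨ pathLength-ʳ++ x (odds zs) y (evens zs) ⟩
        len (odds xs) + (d x y + len (evens xs))
          ≈⟨ solve 3 (λ o a e → o :+ (a :+ e) := a :+ (o :+ e))
               refl (len (odds xs)) (d x y) (len (evens xs)) ⟩
        d x y + (len (odds xs) + len (evens xs))              ≤⟨ +-mono-≤ ≤-refl (odds-evens-length 0≤w skips) ⟩
        d x y + (1# + c) * w                                  ∎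
    snake-bound () (_ ∷ [] , ≡.refl , _)

    -- If t = k - r were positive, snake-bound would give t K ≤ S for every K.
    snakes⇒k≤ : ∀ {T k r} → 1 ℕ.≤ k → (∀ K → fromℕ 2 ≤ K → ∃[ w ] 0# < w × Snake T k K w) →
                IsUpperBound _≤_ (OrderRatio M T k) r → fromℕ k ≤ r
    snakes⇒k≤ {T} {k} {r} 1≤k snakes upper = ≮⇒≥ contradiction
      where
      open ≤-Reasoning
      c = fromℕ k
      0≤c : 0# ≤ c
      0≤c = fromℕ-nonNeg k
      -- The coefficient of `w` in the error terms of `snake-bound`, after bounding `r` by `c`.
      S = (1# + c) * c + c * c
      0≤S : 0# ≤ S
      0≤S = +-nonNeg (*-nonNeg (+-nonNeg 0≤1 0≤c) 0≤c) (*-nonNeg 0≤c 0≤c)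
      contradiction : ¬ (r < c)
      contradiction (r≤c , r≉c) with gap r c
      ... | t , r+t≈c with reciprocal 0<t
        where
        0<t : 0# < t
        0<t = ≰⇒> λ t≤0 → r≉c (≤-antisym r≤c (begin
          c       ≈⟨ r+t≈c ⟨
          r + t   ≤⟨ +-mono-≤ ≤-refl t≤0 ⟩
          r + 0#  ≈⟨ +-identityʳ r ⟩
          r       ∎))
      -- This factor exceeds `S` after multiplication by `t`; its summand 2 meets the lower bound
      -- required of `K`.
      ... | t⁻¹ , 0≤t⁻¹ , tt⁻¹≈1 with snakes (fromℕ 2 + t⁻¹ * (S + 1#)) (x≤x+y (*-nonNeg 0≤t⁻¹ (+-nonNeg 0≤S 0≤1)))
      ... | w , 0<w , snake with snake-bound {T} 1≤k snake (proj₁ 0<w) upper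
      ... | a , Kw≤a , ca≤ = <⇒≱ 0<w (+-cancelʳ-≤ (S * w) (begin
        w + S * w
          ≈⟨ solve 2 (λ w S → w :+ S :* w := con 1 :* ((S :+ con 1) :* w))
               refl w S ⟩
        1# * ((S + 1#) * w)               ≈⟨ *-congʳ tt⁻¹≈1 ⟨
        t * t⁻¹ * ((S + 1#) * w)          ≤⟨ x≤x+y (*-nonNeg 0≤t (*-nonNeg (fromℕ-nonNeg 2) 0≤w)) ⟩
        t * t⁻¹ * ((S + 1#) * w) + t * (fromℕ 2 * w)
                                          ≈⟨ solve 5 (λ t i s w n → t :* i :* (s :* w) :+ t :* (n :* w) := t :* ((n :+ i :* s) :* w))
                                               refl t t⁻¹ (S + 1#) w (fromℕ 2) ⟩
        t * ((fromℕ 2 + t⁻¹ * (S + 1#)) * w)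
                                          ≤⟨ *-monoˡ-≤ t 0≤t Kw≤a ⟩
        t * a                             ≤⟨ ta≤ ⟩
        S * w                             ≈⟨ +-identityˡ _ ⟨
        0# + S * w                        ∎))
        where
        0≤w : 0# ≤ w
        0≤w = proj₁ 0<w
        0≤t : 0# ≤ t
        0≤t = rearrange (trans (+-identityˡ c) (trans (sym r+t≈c) (+-comm r t))) r≤c
        ta≤ : t * a ≤ S * w
        ta≤ = rearrange
          (begin-equality
            t * a + (r * (a + (1# + c) * w) + (c * c) * w + (1# + c) * (c * w))
              ≈⟨ solve 5 (λ t a r c w →
                   t :* a :+ (r :* (a :+ (con 1 :+ c) :* w) :+ (c :* c) :* w :+ (con 1 :+ c) :* (c :* w))
                   := ((con 1 :+ c) :* c :+ c :* c) :* w :+ ((r :+ t) :* a :+ (con 1 :+ c) :* (r :* w)))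
                   refl t a r c w ⟩
            S * w + ((r + t) * a + (1# + c) * (r * w))
              ≈⟨ +-congˡ (+-congʳ (*-congʳ r+t≈c)) ⟩
            S * w + (c * a + (1# + c) * (r * w)) ∎)
          (+-mono-≤ ca≤ (*-monoˡ-≤ (1# + c) (+-nonNeg 0≤1 0≤c) (*-monoʳ-≤ w 0≤w r≤c)))

  -- The infimum over all orders.

  module _ (ext : Extensionality 0ℓ 0ℓ) where

    open Func using (to; cong)

    someOrder : (M : MetricSpace ℝ) → Order M
    someOrder M = record { isTotalOrder = Zermelo.≤-isTotalOrder decide ext (MetricSpace.setoid M) }

    -- The lower-bound half of `OR M k (fromℕ k)`. For `k` at least 1 it is equivalent to the whole,
    -- since no order has a value above `k`.
    NoDrop : MetricSpace ℝ → ℕ → Set₁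
    NoDrop M k = ∀ T r → ORᵀ M T k r → fromℕ k ≤ r

    -- Excludes the conventional value of a space without two points.
    k≰1 : ∀ {k r} → 2 ℕ.≤ k → r ≈ 1# → ¬ (fromℕ k ≤ r)
    k≰1 {k} {r} 2≤k r≈1 k≤r = <⇒≱ 0<1 (rearrange
      (solve 0 (con 1 :+ con 1 := con 0 :+ (con 1 :+ (con 1 :+ con 0))) refl)
      (≤-trans (fromℕ-mono 2≤k) (≤-trans k≤r (≤-reflexive r≈1))))

    NoDrop⇒snakes : ∀ {M k} → 2 ℕ.≤ k → NoDrop M k → ∀ T K → fromℕ 2 ≤ K → ∃[ w ] Snake M T k K w
    NoDrop⇒snakes {M} {k} 2≤k noDrop T K 2≤K
      with ORᵀ-exists M T (ℕ.≤-trans (s≤s z≤n) 2≤k)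
    ... | r , value@(sup _ isSup)    = ratio⇒snake M {T} isSup (noDrop T r value) 2≤K
    ... | r , value@(trivial _ r≈1) = ⊥-elim (k≰1 2≤k r≈1 (noDrop T r value))

    NoDrop⇒OR : ∀ {M k} → 1 ℕ.≤ k → NoDrop M k → OR M k (fromℕ k)
    NoDrop⇒OR {M} 1≤k noDrop = (λ { r (T , value) → noDrop T r value }) , λ l lower →
      let T = someOrder M
          r , value = ORᵀ-exists M T 1≤k
      in ≤-trans (lower r (T , value)) (ORᵀ≤k M T 1≤k value)

    OR⇒NoDrop : ∀ {M k} → OR M k (fromℕ k) → NoDrop M k
    OR⇒NoDrop (lower , _) T r value = lower r (T , value)

    -- Snakes under quasi-isometric embeddings.

    module _ {N M : MetricSpace ℝ} (α : Func (MetricSpace.setoid N) (MetricSpace.setoid M)) where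

      private
        module N where
          open MetricSpace N public
          open IsGeneralMetric isMetric public hiding (cong)
        module M where
          open MetricSpace M public
          open IsGeneralMetric isMetric public hiding (cong)

      -- Fibres of α are ordered arbitrarily.
      pullback : Order M → Order N
      pullback T = record
        { _≤_          = _≲_
        ; isTotalOrder = record
          { isPartialOrder = record
            { isPreorder = record
              { isEquivalence = N.≈-isEquivalence
              ; reflexive     = λ x≈y → L.reflexive (cong α x≈y , x≈y)
              ; trans         = λ {x} {y} {z} → L.trans {f x} {f y} {f z}
              }
            ; antisym = λ {x} {y} x≤y y≤x → proj₂ (L.antisym {f x} {f y} x≤y y≤x)
            }
          ; total = λ x y → L.total (f x) (f y)
          }
        }
        where
        f : N.Carrier → M.Carrier × N.Carrier
        f x = to α x , x
        _≲_ : Rel N.Carrier 0ℓ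
        _≲_ = ×-Lex M._≈_ (Order._≤_ T) (Order._≤_ (someOrder N)) on f
        module L = IsTotalOrder (×-isTotalOrder {_≈₁_ = M._≈_} {_≤₁_ = Order._≤_ T} (λ _ _ → decide _)
                     (Order.isTotalOrder T) (Order.isTotalOrder (someOrder N)))

      pullback-mono : ∀ T {x y} → Order._≤_ (pullback T) x y → Order._≤_ T (to α x) (to α y)
      pullback-mono T (inj₁ (αx≤αy , _)) = αx≤αy
      pullback-mono T (inj₂ (αx≈αy , _)) = IsTotalOrder.reflexive (Order.isTotalOrder T) αx≈αy

      -- `α` may identify points, so distinctness comes from distances: neighbouring images are
      -- weakly ordered and at least `a` apart, hence strictly ordered, and transitivity separates
      -- all pairs.
      Unique-map : ∀ {T : Order M} {a xs} → 0# < a → Linked (Order._≤_ T) (map (to α) xs) →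
                   Linked (λ x y → a ≤ M.d x y) (map (to α) xs) → UniqueSetoid.Unique M.setoid (map (to α) xs)
      Unique-map {T} 0<a sorted far =
        AllPairs.map proj₂ (Linked.Linked⇒AllPairs
          (NonStrictToStrict.<-trans M._≈_ (Order._≤_ T) (IsTotalOrder.isPartialOrder (Order.isTotalOrder T)))
          (Linked.zipWith (λ { (x≤y , a≤d) → x≤y , λ x≈y → <⇒≱ 0<a (≤-trans a≤d (d≤0 M x≈y)) }) (sorted , far)))

      -- `K′` is fixed before the order and the snake are known, so it depends only on `K`, `δ` and
      -- the constants of `α`.
      embedding⇒snake : UniformlyDiscrete N → IsQuasiIsometricEmbedding N M α →
                        ∀ {k} K → 2 ℕ.≤ k → fromℕ 2 ≤ K → ∃[ K′ ] fromℕ 2 ≤ K′ ×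
                        (∀ T w → Snake N (pullback T) k K′ w → ∃[ w′ ] 0# < w′ × Snake M T k K w′)
      embedding⇒snake (δ , 0<δ , discrete) (C₁ , C₁⁻¹ , C₂ , 1≤C₁ , C₁C₁⁻¹≈1 , 0≤C₂ , quasi) {k} K 2≤k 2≤K
        with reciprocal 0<δ
      ... | δ⁻¹ , 0≤δ⁻¹ , δδ⁻¹≈1 = K′ , x≤x+y (*-nonNeg 0≤C₁ (+-nonNeg (*-nonNeg 0≤K 0≤B) 0≤C₂δ⁻¹)) , transfer
        where
        open ≤-Reasoning
        0≤K = ≤-trans (fromℕ-nonNeg 2) 2≤K
        0≤C₁ = ≤-trans 0≤1 1≤C₁
        0≤C₂δ⁻¹ = *-nonNeg 0≤C₂ 0≤δ⁻¹
        -- The growth of the width: `C₁ * w + C₂ ≤ B * w` as soon as `δ ≤ w`.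
        B = C₁ + C₂ * δ⁻¹
        0≤B = +-nonNeg 0≤C₁ 0≤C₂δ⁻¹
        -- After division by `C₁` and the loss of `C₂`, an edge of length `K′ * w` must retain
        -- `K * (B * w)`; the summand 2 gives `fromℕ 2 ≤ K′`.
        K′ = fromℕ 2 + C₁ * (K * B + C₂ * δ⁻¹)
        0≤C₁⁻¹ : 0# ≤ C₁⁻¹
        0≤C₁⁻¹ = inverse-pos (<-≤-trans 0<1 1≤C₁) C₁C₁⁻¹≈1
        transfer : ∀ T w → Snake N (pullback T) k K′ w → ∃[ w′ ] 0# < w′ × Snake M T k K w′
        transfer T w snake@(xs , |xs| , _ , sorted , far , near) =
          B * w , 0<Bw , map (to α) xs , ≡.trans (length-map (to α) xs) |xs| ,
          Unique-map {T} 0<KBw sorted′ far′ , sorted′ , far′ , SkipLinked-map near-image near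
          where
          δ≤w : δ ≤ w
          δ≤w with snake-diam N {pullback T} 2≤k snake
          ... | x , z , x≉z , dxz≤w = ≤-trans (discrete x z x≉z) dxz≤w
          0≤w : 0# ≤ w
          0≤w = ≤-trans (proj₁ 0<δ) δ≤w
          0<w : 0# < w
          0<w = <-≤-trans 0<δ δ≤w
          w≤Bw : w ≤ B * w
          w≤Bw = begin
            w       ≈⟨ *-identityˡ w ⟨
            1# * w  ≤⟨ *-monoʳ-≤ w 0≤w (≤-trans 1≤C₁ (x≤x+y 0≤C₂δ⁻¹)) ⟩
            B * w   ∎
          0<Bw : 0# < B * w
          0<Bw = <-≤-trans 0<w w≤Bw
          0<KBw : 0# < K * (B * w)
          0<KBw = <-≤-trans 0<Bw (begin
            B * w        ≈⟨ *-identityˡ _ ⟨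
            1# * (B * w) ≤⟨ *-monoʳ-≤ (B * w) (proj₁ 0<Bw) (≤-trans (x≤x+y (fromℕ-nonNeg 1)) 2≤K) ⟩
            K * (B * w)  ∎)
          -- Uniform discreteness turns the additive constant into a multiple of w.
          C₂≤ : C₂ ≤ C₂ * δ⁻¹ * w
          C₂≤ = begin
            C₂                ≈⟨ *-identityʳ C₂ ⟨
            C₂ * 1#           ≈⟨ *-congˡ δδ⁻¹≈1 ⟨
            C₂ * (δ * δ⁻¹)    ≈⟨ solve 3 (λ c d i → c :* (d :* i) := c :* i :* d) refl C₂ δ δ⁻¹ ⟩
            C₂ * δ⁻¹ * δ      ≤⟨ *-monoˡ-≤ (C₂ * δ⁻¹) 0≤C₂δ⁻¹ δ≤w ⟩
            C₂ * δ⁻¹ * w      ∎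
          near-image : ∀ {x z} → N.d x z ≤ w → M.d (to α x) (to α z) ≤ B * w
          near-image {x} {z} dxz≤w = begin
            M.d (to α x) (to α z)    ≤⟨ proj₂ (quasi x z) ⟩
            C₁ * N.d x z + C₂        ≤⟨ +-mono-≤ (*-monoˡ-≤ C₁ 0≤C₁ dxz≤w) C₂≤ ⟩
            C₁ * w + C₂ * δ⁻¹ * w    ≈⟨ distribʳ w C₁ (C₂ * δ⁻¹) ⟨
            B * w                    ∎
          far-image : ∀ {x y} → K′ * w ≤ N.d x y → K * (B * w) ≤ M.d (to α x) (to α y)
          far-image {x} {y} K′w≤d = +-cancelʳ-≤ (C₂ * δ⁻¹ * w) (begin
            K * (B * w) + C₂ * δ⁻¹ * w
              ≈⟨ solve 4 (λ K B c w → K :* (B :* w) :+ c :* w := con 1 :* (K :* B :+ c) :* w)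
                   refl K B (C₂ * δ⁻¹) w ⟩
            1# * (K * B + C₂ * δ⁻¹) * w
              ≈⟨ *-congʳ (*-congʳ C₁C₁⁻¹≈1) ⟨
            C₁ * C₁⁻¹ * (K * B + C₂ * δ⁻¹) * w
              ≤⟨ x≤x+y (*-nonNeg 0≤C₁⁻¹ (*-nonNeg (fromℕ-nonNeg 2) 0≤w)) ⟩
            C₁ * C₁⁻¹ * (K * B + C₂ * δ⁻¹) * w + C₁⁻¹ * (fromℕ 2 * w)
              ≈⟨ solve 5 (λ c i s w n → c :* i :* s :* w :+ i :* (n :* w) := i :* ((n :+ c :* s) :* w))
                   refl C₁ C₁⁻¹ (K * B + C₂ * δ⁻¹) w (fromℕ 2) ⟩
            C₁⁻¹ * (K′ * w)
              ≤⟨ *-monoˡ-≤ C₁⁻¹ 0≤C₁⁻¹ K′w≤d ⟩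
            C₁⁻¹ * N.d x y
              ≈⟨ trans (+-assoc _ _ _) (trans (+-congˡ (-‿inverseˡ C₂)) (+-identityʳ _)) ⟨
            C₁⁻¹ * N.d x y + (- C₂) + C₂
              ≤⟨ +-mono-≤ (proj₁ (quasi x y)) C₂≤ ⟩
            M.d (to α x) (to α y) + C₂ * δ⁻¹ * w ∎)
          sorted′ : Linked (Order._≤_ T) (map (to α) xs)
          sorted′ = Linked.map⁺ (Linked.map (pullback-mono T) sorted)
          far′ : Linked (λ x y → K * (B * w) ≤ M.d x y) (map (to α) xs)
          far′ = Linked.map⁺ (Linked.map far-image far)

      -- Each order on `M` is tested through its pullback to `N`. The transferred snakes also
      -- provide two distinct points of `M`, so the value there is a genuine supremum.
      NoDrop-embedding : ∀ {k} → 2 ℕ.≤ k → UniformlyDiscrete N → IsQuasiIsometricEmbedding N M α →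
                         NoDrop N k → NoDrop M k
      NoDrop-embedding {k} 2≤k discrete quasi noDrop T r = λ
        { (sup _ (upper , _)) → snakes⇒k≤ M {T} (ℕ.≤-trans (s≤s z≤n) 2≤k) snakes upper
        ; (trivial ¬two _)    → ⊥-elim (¬two two)
        }
        where
        snakes : ∀ K → fromℕ 2 ≤ K → ∃[ w ] 0# < w × Snake M T k K w
        snakes K 2≤K =
          let K′ , 2≤K′ , transfer = embedding⇒snake discrete quasi K 2≤k 2≤K
              w , snake            = NoDrop⇒snakes 2≤k noDrop (pullback T) K′ 2≤K′
          in transfer T w snake
        two : HasTwoPoints M
        two =
          let _ , _ , snake     = snakes (fromℕ 2) ≤-refl
              x , z , x≉z , _ = snake-diam M {T = T} 2≤k snake
          in x , z , x≉z

    -- Quasi-inverses.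

    module _ {N M : MetricSpace ℝ} where

      private
        module N where
          open MetricSpace N public
          open IsGeneralMetric isMetric public hiding (cong)
        module M where
          open MetricSpace M public
          open IsGeneralMetric isMetric public hiding (cong)

      -- A point is sent to one whose image under `α` lies near it; the estimates for `α` then carry
      -- over at the cost of two such displacements.
      quasiInverse : (α : Func N.setoid M.setoid) → IsQuasiIsometry N M α →
                     ∃[ β ] IsQuasiIsometricEmbedding M N β
      quasiInverse α ((C₁ , C₁⁻¹ , C₂ , 1≤C₁ , C₁C₁⁻¹≈1 , 0≤C₂ , quasi) , D , dense) =
        β , C₁ , C₁⁻¹ , C₁ * c , 1≤C₁ , C₁C₁⁻¹≈1 , *-nonNeg 0≤C₁ 0≤c , λ x y → lower-bound x y , upper-bound x y
        where
        open ≤-Reasoning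
        -- `dense` need not respect `_≈_`, so it is applied to canonical representatives.
        rep : M.Carrier → M.Carrier
        rep = Zermelo.canonical decide ext M.setoid
        b : M.Carrier → N.Carrier
        b m = proj₁ (dense (rep m))
        β : Func M.setoid N.setoid
        β = record
          { to   = b
          ; cong = λ {x} {y} x≈y → ≡.subst (λ m → b x N.≈ proj₁ (dense m))
                                      (Zermelo.canonical-cong decide ext M.setoid x≈y) N.EqC.refl
          }
        0≤C₁ = ≤-trans 0≤1 1≤C₁
        -- D may be negative if M is empty.
        bound : ∃[ e ] 0# ≤ e × D ≤ e
        bound with ≤-total 0# D
        ... | inj₁ 0≤D = D , 0≤D , ≤-refl
        ... | inj₂ D≤0 = 0# , ≤-refl , D≤0
        e = proj₁ bound
        0≤e = proj₁ (proj₂ bound)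
        -- The additive error: `C₂` from `α` and one `e` per endpoint. The upper estimate multiplies
        -- it by `C₁`, the lower one only by `C₁⁻¹`, which is at most `C₁`.
        c = C₂ + (e + e)
        0≤c : 0# ≤ c
        0≤c = +-nonNeg 0≤C₂ (+-nonNeg 0≤e 0≤e)
        0≤C₁⁻¹ : 0# ≤ C₁⁻¹
        0≤C₁⁻¹ = inverse-pos (<-≤-trans 0<1 1≤C₁) C₁C₁⁻¹≈1
        near : ∀ m → M.d m (to α (b m)) ≤ e
        near m = begin
          M.d m (to α (b m))        ≈⟨ d-congˡ M (M.EqC.sym (Zermelo.canonical-≈ decide ext M.setoid m)) ⟩
          M.d (rep m) (to α (b m))  ≤⟨ proj₂ (dense (rep m)) ⟩
          D                         ≤⟨ proj₂ (proj₂ bound) ⟩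
          e                         ∎
        near′ : ∀ m → M.d (to α (b m)) m ≤ e
        near′ m = ≤-trans (≤-reflexive (M.sym _ _)) (near m)
        detour : ∀ x x′ y y′ → M.d x x′ ≤ e → M.d y y′ ≤ e → M.d x y ≤ M.d x′ y′ + (e + e)
        detour x x′ y y′ xx′ yy′ = begin
          M.d x y                              ≤⟨ M.triangle x x′ y ⟩
          M.d x x′ + M.d x′ y                  ≤⟨ +-mono-≤ xx′ (M.triangle x′ y′ y) ⟩
          e + (M.d x′ y′ + M.d y′ y)           ≤⟨ +-mono-≤ ≤-refl (+-mono-≤ ≤-refl (≤-trans (≤-reflexive (M.sym y′ y)) yy′)) ⟩
          e + (M.d x′ y′ + e)
            ≈⟨ solve 2 (λ e f → e :+ (f :+ e) := f :+ (e :+ e))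
                 refl e (M.d x′ y′) ⟩
          M.d x′ y′ + (e + e)                  ∎
        image : M.Carrier → M.Carrier
        image m = to α (b m)
        lower-bound : ∀ x y → (C₁⁻¹ * M.d x y) + (- (C₁ * c)) ≤ N.d (b x) (b y)
        lower-bound x y = +-cancelʳ-≤ (C₁ * c) (begin
          C₁⁻¹ * M.d x y + (- (C₁ * c)) + C₁ * c
            ≈⟨ trans (+-assoc _ _ _) (trans (+-congˡ (-‿inverseˡ _)) (+-identityʳ _)) ⟩
          C₁⁻¹ * M.d x y
            ≤⟨ *-monoˡ-≤ C₁⁻¹ 0≤C₁⁻¹ (detour x (image x) y (image y) (near x) (near y)) ⟩
          C₁⁻¹ * (M.d (image x) (image y) + (e + e))
            ≤⟨ *-monoˡ-≤ C₁⁻¹ 0≤C₁⁻¹ (+-monoˡ-≤ _ (proj₂ (quasi (b x) (b y)))) ⟩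
          C₁⁻¹ * (C₁ * N.d (b x) (b y) + C₂ + (e + e))
            ≈⟨ solve 5 (λ i c n d e → i :* (c :* n :+ d :+ (e :+ e)) := (c :* i) :* n :+ i :* (d :+ (e :+ e)))
                 refl C₁⁻¹ C₁ (N.d (b x) (b y)) C₂ e ⟩
          C₁ * C₁⁻¹ * N.d (b x) (b y) + C₁⁻¹ * c
            ≤⟨ +-mono-≤ (≤-reflexive (trans (*-congʳ C₁C₁⁻¹≈1) (*-identityˡ _))) (*-monoʳ-≤ c 0≤c C₁⁻¹≤C₁) ⟩
          N.d (b x) (b y) + C₁ * c ∎)
          where
          C₁⁻¹≤C₁ : C₁⁻¹ ≤ C₁
          C₁⁻¹≤C₁ = begin
            C₁⁻¹        ≈⟨ *-identityˡ _ ⟨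
            1# * C₁⁻¹   ≤⟨ *-monoʳ-≤ C₁⁻¹ 0≤C₁⁻¹ 1≤C₁ ⟩
            C₁ * C₁⁻¹   ≈⟨ C₁C₁⁻¹≈1 ⟩
            1#          ≤⟨ 1≤C₁ ⟩
            C₁          ∎
        upper-bound : ∀ x y → N.d (b x) (b y) ≤ (C₁ * M.d x y) + (C₁ * c)
        upper-bound x y = begin
          N.d (b x) (b y)
            ≈⟨ trans (*-congʳ C₁C₁⁻¹≈1) (*-identityˡ _) ⟨
          C₁ * C₁⁻¹ * N.d (b x) (b y)
            ≈⟨ *-assoc _ _ _ ⟩
          C₁ * (C₁⁻¹ * N.d (b x) (b y))
            ≤⟨ *-monoˡ-≤ C₁ 0≤C₁ (begin
              C₁⁻¹ * N.d (b x) (b y)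
                ≈⟨ trans (+-assoc _ _ _) (trans (+-congˡ (-‿inverseˡ C₂)) (+-identityʳ _)) ⟨
              C₁⁻¹ * N.d (b x) (b y) + (- C₂) + C₂
                ≤⟨ +-monoˡ-≤ C₂ (proj₁ (quasi (b x) (b y))) ⟩
              M.d (image x) (image y) + C₂
                ≤⟨ +-monoˡ-≤ C₂ (detour (image x) x (image y) y (near′ x) (near′ y)) ⟩
              M.d x y + (e + e) + C₂
                ≈⟨ solve 3 (λ m e d → m :+ (e :+ e) :+ d := m :+ (d :+ (e :+ e))) refl (M.d x y) e C₂ ⟩
              M.d x y + c ∎) ⟩
          C₁ * (M.d x y + c)
            ≈⟨ distribˡ C₁ (M.d x y) c ⟩
          C₁ * M.d x y + C₁ * c ∎

    -- Breakpoints.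

    module _ (decide₁ : ∀ (P : Set₁) → Dec P) where

      -- The breakpoint of `M` is the least `s` with this property, or infinity if there is none, so
      -- equivalent predicates give equal breakpoints.
      HasDrop : MetricSpace ℝ → ℕ → Set₁
      HasDrop M s = Σ[ T ∈ Order M ] Drops M T s

      -- Every ratio is at least 1. This settles the one positive parameter below the range of the
      -- snake argument.
      noDrop-1 : ∀ M → NoDrop M 1
      noDrop-1 M T r (trivial _ r≈1) = ≤-reflexive (trans (+-identityʳ 1#) (sym r≈1))
      noDrop-1 M T r (sup two (upper , _)) with OrderRatio-inhabited M T ℕ.≤-refl two
      ... | q , ratio = ≤-trans (≤-trans (≤-reflexive (+-identityʳ 1#)) (1≤OrderRatio M T ratio)) (upper q ratio)

      -- The contrapositive of `NoDrop-embedding`: a drop travels against the direction of the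
      -- embedding.
      HasDrop-embedding : ∀ {N M} (α : Func (MetricSpace.setoid N) (MetricSpace.setoid M)) →
                          UniformlyDiscrete N → IsQuasiIsometricEmbedding N M α → ∀ s → HasDrop M s → HasDrop N s
      HasDrop-embedding {N} {M} α discrete quasi s (T , 1≤s , r , value , r<s) with decide₁ (HasDrop N s)
      ... | yes drop = drop
      ... | no none  = ⊥-elim (<⇒≱ r<s (noDropM s 1≤s noDropN T r value))
        where
        noDropN : NoDrop N s
        noDropN T′ r′ value′ = ≮⇒≥ λ r′<s → none (T′ , 1≤s , r′ , value′ , r′<s)
        noDropM : ∀ s → 1 ℕ.≤ s → NoDrop N s → NoDrop M s
        noDropM 1 _ _ = noDrop-1 M
        noDropM (ℕ.suc (ℕ.suc s)) _ = NoDrop-embedding α (s≤s (s≤s z≤n)) discrete quasi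

      least : ∀ {P : ℕ → Set₁} n → P n → Σ[ m ∈ ℕ ] P m × (∀ j → P j → m ℕ.≤ j)
      least {P} = <-rec (λ n → P n → Σ[ m ∈ ℕ ] P m × (∀ j → P j → m ℕ.≤ j)) go
        where
        go : ∀ n → (∀ {j} → j ℕ.< n → P j → Σ[ m ∈ ℕ ] P m × (∀ j → P j → m ℕ.≤ j)) →
             P n → Σ[ m ∈ ℕ ] P m × (∀ j → P j → m ℕ.≤ j)
        go n rec Pn with decide₁ (Σ[ j ∈ ℕ ] j ℕ.< n × P j)
        ... | yes (j , j<n , Pj) = rec j<n Pj
        ... | no none            = n , Pn , λ j Pj → ℕ.≮⇒≥ λ j<n → none (j , j<n , Pj)

      -- The order `T` itself has breakpoint `s`, since an earlier drop of `T` would be an earlier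
      -- drop of `M`; and every finite breakpoint of an order is a drop of `M`.
      Br-least : ∀ {M s} → HasDrop M s → (∀ j → HasDrop M j → s ℕ.≤ j) → Br M [ s ]
      Br-least {M} {s} (T , drop) minimal = (T , drop , λ j dropⱼ → minimal j (T , dropⱼ)) , λ
        { [ j ] (T′ , drop′ , _) → [ minimal j (T′ , drop′) ]
        ; ⊤⁺    _                → [ s ] ≤⊤⁺
        }

      Br-∞ : ∀ {M} → (∀ j → ¬ HasDrop M j) → Br M ⊤⁺
      Br-∞ {M} none = (someOrder M , λ s drop → none s (someOrder M , drop)) , λ
        { [ j ] (T , drop , _) → ⊥-elim (none j (T , drop))
        ; ⊤⁺    _              → ⊤⁺ ≤⊤⁺
        }

      Br-≡ : ∀ {N M} → (∀ s → HasDrop N s → HasDrop M s) → (∀ s → HasDrop M s → HasDrop N s) →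
             ∃[ b ] Br N b × Br M b
      Br-≡ {N} {M} N⇒M M⇒N with decide₁ (Σ[ s ∈ ℕ ] HasDrop N s)
      ... | no none = ⊤⁺ , Br-∞ (λ s drop → none (s , drop)) , Br-∞ (λ s drop → none (s , M⇒N s drop))
      ... | yes (n , dropₙ) with least {HasDrop N} n dropₙ
      ... | s , drop , minimal =
        [ s ] , Br-least drop minimal , Br-least (N⇒M s drop) (λ j dropⱼ → minimal j (M⇒N j dropⱼ))

open import Data.Nat.Base using (_≤_)

lemma2p13 : ExcludedMiddle (suc 0ℓ) → Extensionality 0ℓ 0ℓ →
    (ℝ : RealField) →
    ((k : ℕ) → 2 ≤ k → (N M : MetricSpace ℝ) →
    UniformlyDiscrete N → OR N k (RealField.fromℕ ℝ k) →
    (α : Func (MetricSpace.setoid N) (MetricSpace.setoid M)) →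
    IsQuasiIsometricEmbedding N M α →
    OR M k (RealField.fromℕ ℝ k))
    ×
    ((N M : MetricSpace ℝ) → UniformlyDiscrete N → UniformlyDiscrete M →
    QuasiIsometric N M → ∃[ b ] Br N b × Br M b)
lemma2p13 lem ext ℝ = part₁ , part₂
  where
  decide : ∀ (P : Set) → Dec P
  decide P = map′ lower lift (lem {Lift (suc 0ℓ) P})
  decide₁ : ∀ (P : Set₁) → Dec P
  decide₁ P = lem
  part₁ : (k : ℕ) → 2 ≤ k → (N M : MetricSpace ℝ) →
          UniformlyDiscrete N → OR N k (RealField.fromℕ ℝ k) →
          (α : Func (MetricSpace.setoid N) (MetricSpace.setoid M)) →
          IsQuasiIsometricEmbedding N M α →
          OR M k (RealField.fromℕ ℝ k)
  part₁ k 2≤k N M discrete or α quasi =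
    NoDrop⇒OR ℝ decide ext {M} (ℕ.≤-trans (s≤s z≤n) 2≤k)
      (NoDrop-embedding ℝ decide ext {N} {M} α 2≤k discrete quasi (OR⇒NoDrop ℝ decide ext {N} or))
  part₂ : (N M : MetricSpace ℝ) → UniformlyDiscrete N → UniformlyDiscrete M →
          QuasiIsometric N M → ∃[ b ] Br N b × Br M b
  part₂ N M discreteN discreteM (α , isometry) =
    let β , quasi-β = quasiInverse ℝ decide ext {N} {M} α isometry
    in Br-≡ ℝ decide ext decide₁ {N} {M}
         -- The quasi-inverse, starting in the discrete space `M`, carries drops of `N` to drops of
         -- `M`.
         (HasDrop-embedding ℝ decide ext decide₁ β discreteM quasi-β)
         (HasDrop-embedding ℝ decide ext decide₁ α discreteN (proj₁ isometry))
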